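{- Let $T=\{1234,3412,4123\}$ and let $F_T(x)=\sum_{n\ge0}|S_n(T)|x^n$. Then $$F_T(x)=\frac{1-14x+87x^2-315x^3+736x^4-1161x^5+1253x^6-918x^7+446x^8-134x^9+18x^{10}}{(1-x)^6(1-2x)^3(1-3x+x^2)}.$$
   Context: $S_n$ is the set of permutations of $[n]$ ($S_0$ contains the empty permutation). A permutation avoids a pattern $\tau$ if it has no subsequence order-isomorphic to $\tau$; $S_n(T)$ is the set of permutations in $S_n$ avoiding every pattern in $T$. -}

module Defs where

open import Data.Bool using (Bool; true; false; _∧_; if_then_else_)
open import Data.Nat using (ℕ; zero; suc; _<ᵇ_; _≡ᵇ_)
open import Data.List using (List; []; _∷_; map; filter; length; concatMap; upTo; foldr; zipWith; replicate)
open import Data.Integer using (ℤ; +_; -[1+_]; -_) renaming (_+_ to _+ℤ_; _*_ to _*ℤ_)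
open import Relation.Nullary.Decidable using (does)
open import Data.Bool.Properties using (T?)
open import Data.Bool.ListAction using (all; any)

-- Permutations of [n] = {1,…,n}, represented in one-line notation as
-- lists of natural numbers.

allWords : ℕ → ℕ → List (List ℕ)
allWords n zero    = [] ∷ []
allWords n (suc k) = concatMap (λ w → map (λ i → suc i ∷ w) (upTo n)) (allWords n k)

occ : ℕ → List ℕ → ℕ
occ i []       = 0
occ i (x ∷ xs) = if i ≡ᵇ x then suc (occ i xs) else occ i xs

isPermOf : ℕ → List ℕ → Bool
isPermOf n xs = (length xs ≡ᵇ n) ∧ all (λ i → occ (suc i) xs ≡ᵇ 1) (upTo n)

-- S_n as an explicit duplicate-free list
Sn : ℕ → List (List ℕ)
Sn n = filter (λ w → T? (isPermOf n w)) (allWords n n)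

subseqs : {A : Set} → List A → List (List A)
subseqs []       = [] ∷ []
subseqs (x ∷ xs) = map (x ∷_) (subseqs xs) Data.List.++ subseqs xs

sameOrder : ℕ → ℕ → ℕ → ℕ → Bool
sameOrder x y u v = ((x <ᵇ y) ≡ᵇB (u <ᵇ v)) ∧ ((y <ᵇ x) ≡ᵇB (v <ᵇ u))
  where
  _≡ᵇB_ : Bool → Bool → Bool
  true  ≡ᵇB b = b
  false ≡ᵇB true  = false
  false ≡ᵇB false = true

orderIso : List ℕ → List ℕ → Bool
orderIso []       []       = true
orderIso (x ∷ xs) (u ∷ us) =
  all (λ b → b) (zipWith (λ y v → sameOrder x y u v) xs us) ∧ orderIso xs us
orderIso _        _        = false

contains : List ℕ → List ℕ → Bool
contains σ τ = any (λ s → orderIso s τ) (subseqs σ)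

avoidsAll : List (List ℕ) → List ℕ → Bool
avoidsAll T σ = all (λ τ → Data.Bool.not (contains σ τ)) T

countAvoiders : List (List ℕ) → ℕ → ℕ
countAvoiders T n = length (filter (λ σ → T? (avoidsAll T σ)) (Sn n))

-- Polynomials over ℤ as coefficient lists (constant term first)

Poly : Set
Poly = List ℤ

_+ₚ_ : Poly → Poly → Poly
[]       +ₚ q        = q
p        +ₚ []       = p
(a ∷ p)  +ₚ (b ∷ q)  = (a +ℤ b) ∷ (p +ₚ q)

_*ₚ_ : Poly → Poly → Poly
[]      *ₚ q = []
(a ∷ p) *ₚ q = map (a *ℤ_) q +ₚ (+ 0 ∷ (p *ₚ q))

_^ₚ_ : Poly → ℕ → Poly
p ^ₚ zero  = + 1 ∷ []
p ^ₚ suc k = p *ₚ (p ^ₚ k)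

coeff : Poly → ℕ → ℤ
coeff []      n       = + 0
coeff (a ∷ p) zero    = a
coeff (a ∷ p) (suc n) = coeff p n

convCoeff : Poly → (ℕ → ℕ) → ℕ → ℤ
convCoeff P a n = go n
  where
  -- Σ_{k=0}^{j} [x^k]P · a(n-k)  (using a(n - k) with k ≤ j ≤ n)
  go : ℕ → ℤ
  go zero    = coeff P 0 *ℤ (+ a n)
  go (suc j) = go j +ℤ (coeff P (suc j) *ℤ (+ a (n Data.Nat.∸ suc j)))

patternsT : List (List ℕ)
patternsT = (1 ∷ 2 ∷ 3 ∷ 4 ∷ []) ∷ (3 ∷ 4 ∷ 1 ∷ 2 ∷ []) ∷ (4 ∷ 1 ∷ 2 ∷ 3 ∷ []) ∷ []

numerator : Poly
numerator = + 1 ∷ - + 14 ∷ + 87 ∷ - + 315 ∷ + 736 ∷ - + 1161 ∷ + 1253 ∷ - + 918 ∷ + 446 ∷ - + 134 ∷ + 18 ∷ []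

denominator : Poly
denominator = ((+ 1 ∷ - + 1 ∷ []) ^ₚ 6) *ₚ (((+ 1 ∷ - + 2 ∷ []) ^ₚ 3) *ₚ (+ 1 ∷ - + 3 ∷ + 1 ∷ []))

-- Build permutations by inserting 1, 2, 3, … in turn. If M exceeds all entries of αβ, then αMβ avoids
-- T exactly when αβ does and the site (α, β) is active: neither α nor β contains 123, and there are no
-- c in α and a, b (in this order) in β with a < b < c. After the insertion, an active site to the left
-- of M stays active if the entries between it and M decrease; an active site to the right of M stays
-- active if both α and the entries after the site decrease. Hence the number of ways to continue
-- depends only on the positions of the active sites and of the ascents. From the empty permutation
-- only a few families of such configurations are reachable, and the generating functions of their
-- continuations are combinations of powers of 1/(1 − x), of 1/(1 − 2x), and of one sequence that
-- brings in 1 − 3x + x². The resulting sequences form a linear system with constant coefficients.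
module Submission where

open import Defs
open import Relation.Binary.PropositionalEquality using (_≡_; _≢_; refl; sym; trans; cong; cong₂; subst; module ≡-Reasoning)
open import Data.Nat using (ℕ)
open import Data.Bool using (Bool; true; false; T; _∧_; _∨_; not; if_then_else_)
open import Data.Bool.ListAction using (all; any)
open import Data.Bool.Properties using (T-∧; T-∨; T-≡; T?; ¬-not; ∧-identityʳ; ∧-zeroʳ)
open import Data.Empty using (⊥; ⊥-elim)
open import Data.Fin using (Fin; zero; suc; #_)
open import Data.Integer using (ℤ; +_; -[1+_]; _+_; _-_; _*_)
open import Data.Integer.Properties using (+-identityˡ; +-identityʳ; +-assoc; +-comm; pos-+)
open import Data.Integer.Tactic.RingSolver using (solve-∀)
open import Data.List using (List; []; _∷_; _++_; [_]; map; zipWith; concatMap; filter; length; upTo; replicate)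
open import Data.List.Membership.Propositional using (_∈_; find; lose)
open import Data.List.Membership.Propositional.Properties using
  ( ∈-++⁺ˡ; ∈-++⁺ʳ; ∈-++⁻; ∈-map⁺; ∈-map⁻; ∈-concatMap⁺; ∈-concatMap⁻; ∈-upTo⁺; ∈-upTo⁻; ∈-filter⁺; ∈-filter⁻)
open import Data.List.Membership.Propositional.Properties.WithK using (unique∧set⇒bag)
open import Data.List.Properties using
  ( ++-assoc; ++-identityʳ; ++-cancelˡ; length-++; filter-++; filter-all; filter-accept; filter-reject; filter-none
  ; ∷-injectiveˡ; ∷-injectiveʳ)
open import Data.List.Relation.Binary.BagAndSetEquality using (∼bag⇒↭)
open import Data.List.Relation.Binary.Permutation.Propositional.Properties using (↭-length; filter-↭)
open import Data.List.Relation.Binary.Sublist.Propositional using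
  (_⊆_; []; _∷_; _∷ʳ_; ⊆-refl; ⊆-trans; minimum; to∈; from∈)
open import Data.List.Relation.Binary.Sublist.Propositional.Properties using (All-resp-⊆; Any-resp-⊆; ++⁺; ++⁺ˡ)
open import Data.List.Relation.Unary.All as All using (All; []; _∷_)
import Data.List.Relation.Unary.All.Properties as All
open import Data.List.Relation.Unary.AllPairs using (AllPairs; []; _∷_)
open import Data.List.Relation.Unary.Any using (here; there)
open import Data.List.Relation.Unary.Any.Properties using (any⁺; any⁻)
open import Data.List.Relation.Unary.Linked using (Linked; []; [-]; _∷_)
open import Data.List.Relation.Unary.Linked.Properties using (Linked⇒AllPairs)
open import Data.List.Relation.Unary.Unique.Propositional using (Unique)
import Data.List.Relation.Unary.Unique.Propositional.Properties as Unique
open import Data.Nat as ℕ using (zero; suc; _<_; _≤_; _<ᵇ_; _≡ᵇ_)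
import Data.Nat.Properties as ℕ
open import Data.Product using (_×_; _,_; ∃; proj₁; proj₂)
open import Data.Sum using (_⊎_; inj₁; inj₂)
open import Data.Unit using (⊤; tt)
open import Data.Vec as Vec using (Vec; []; _∷_)
open import Function using (_∘_; _⇔_; mk⇔; Equivalence)
open import Function.Construct.Composition using (_⇔-∘_)
open import Relation.Nullary using (¬_; contradiction; yes; no)
open Equivalence using (to; from)
open ≡-Reasoning

-- Words of sites

-- Put y = 1/(1 - x) and z = 1/(1 - 2x). In most families a word with k active sites has one child
-- with each of 1, 2, ..., k active sites, so its generating function is yᵏ. Only words without bars
-- deviate: two of their children are again of this kind, and one of the two has two active sites
-- where the rule asks for one. The excess over yᵏ is therefore one series q for all of them, q = x
-- (2q + y² - y). Families with a growing index are solved by an ansatz. Raising the index by one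
-- multiplies a power of y by y, so the coefficients obey equations in x alone. For `wE` the words
-- with (0, b) and (a, b + 1) both return; dividing by 1 - x - xy = (1 - 3x + x²)/(1 - x) gives the
-- quadratic factor. For `dots d` the divisor is 1 - xy = (1 - 2x)/(1 - x). The forcing term there
-- already contains z, which leads to z² in B and z³ in A. The sixth power of 1/(1 - x) accumulates
-- along q, δ, C, F, K, starting from the y² in q, with one more factor y at each step.

+-congˡ : ∀ x {y z} → y ≡ z → x + y ≡ x + z
+-congˡ x = cong (λ t → x + t)

-- A site of a permutation is recorded by two Booleans: is it active, and is it straddled by an ascent?
-- Sites with neither property never matter again, and `cell` leaves them out. The leftmost site is
-- never straddled by an ascent; its activity is the separate Boolean argument of `weight`.
Cell : Set
Cell = Bool × Bool

pattern • = (true , false)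
pattern ▲ = (true , true)
pattern ∣ = (false , true)

cell : Bool → Bool → List Cell → List Cell
cell false false w = w
cell a     s     w = (a , s) ∷ w

noAsc : List Cell → Bool
noAsc []            = true
noAsc ((_ , s) ∷ w) = not s ∧ noAsc w

-- One rule serves both sides of a new maximum. To its left, a site survives if no ascent lies between
-- it and the maximum. To its right, a site survives if there is no ascent after it and none before
-- the maximum; the latter condition is p.
kill : Bool → List Cell → List Cell
kill p []            = []
kill p ((a , s) ∷ w) = cell (a ∧ (p ∧ noAsc w)) s (kill p w)

-- The arguments are the cells before and after the chosen site. Its own cell disappears: the
-- maximum breaks a possible ascent there and creates a site with an ascent on its left (▲) and one
-- without on its right (•).
next : List Cell → List Cell → List Cell
next u v = kill true u ++ ▲ ∷ kill (noAsc u) (• ∷ v)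

sumActive : (List Cell → List Cell → ℤ) → List Cell → ℤ
sumActive f []            = + 0
sumActive f ((a , s) ∷ w) =
  (if a then f [] w else + 0) + sumActive (λ u v → f ((a , s) ∷ u) v) w

-- Counts the sequences of n further insertions at active sites. An insertion at the leftmost site
-- leaves that site active and has nothing before it, whence the two occurrences of `true`.
weight : ℕ → Bool → List Cell → ℤ
weight zero    a w = + 1
weight (suc n) a w =
  (if a then weight n true (kill true (• ∷ w)) else + 0)
  + sumActive (λ u v → weight n (a ∧ noAsc u) (next u v)) w

-- Sums over sites and survival of sites for runs of dots and bars

dots bars : ℕ → List Cell
dots k = replicate k •
bars k = replicate k ∣

sumActive-cong : ∀ {f g} → (∀ u v → f u v ≡ g u v) → ∀ w → sumActive f w ≡ sumActive g w
sumActive-cong f≗g [] = refl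
sumActive-cong f≗g ((true  , s) ∷ w) = cong₂ _+_ (f≗g [] w) (sumActive-cong (λ u v → f≗g _ v) w)
sumActive-cong f≗g ((false , s) ∷ w) = +-congˡ (+ 0) (sumActive-cong (λ u v → f≗g _ v) w)

-- Runs over i + j = k - 1: the chosen dot has i dots before it and j after it.
Σsplit : (ℕ → ℕ → ℤ) → ℕ → ℤ
Σsplit f zero    = + 0
Σsplit f (suc k) = f 0 k + Σsplit (λ i j → f (suc i) j) k

Σsplit-cong : ∀ {f g : ℕ → ℕ → ℤ} → (∀ i j → f i j ≡ g i j) → ∀ k → Σsplit f k ≡ Σsplit g k
Σsplit-cong f≗g zero    = refl
Σsplit-cong f≗g (suc k) = cong₂ _+_ (f≗g 0 k) (Σsplit-cong (λ i j → f≗g (suc i) j) k)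

Σ< : ℕ → (ℕ → ℤ) → ℤ
Σ< zero    f = + 0
Σ< (suc k) f = Σ< k f + f k

Σ<-suc : ∀ f k → Σ< (suc k) f ≡ f 0 + Σ< k (f ∘ suc)
Σ<-suc f zero    = trans (+-identityˡ (f 0)) (sym (+-identityʳ (f 0)))
Σ<-suc f (suc k) = trans (cong (_+ f (suc k)) (Σ<-suc f k)) (+-assoc (f 0) _ _)

Σsplit≡Σ< : ∀ {f} g → (∀ i j → f i j ≡ g i) → ∀ k → Σsplit f k ≡ Σ< k g
Σsplit≡Σ< g f≗g zero    = refl
Σsplit≡Σ< g f≗g (suc k) =
  trans (cong₂ _+_ (f≗g 0 k) (Σsplit≡Σ< (g ∘ suc) (λ i j → f≗g (suc i) j) k)) (sym (Σ<-suc g k))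

sumActive-dots : ∀ f k w → sumActive f (dots k ++ w)
  ≡ Σsplit (λ i j → f (dots i) (dots j ++ w)) k + sumActive (λ u v → f (dots k ++ u) v) w
sumActive-dots f zero    w = sym (+-identityˡ _)
sumActive-dots f (suc k) w =
  trans (+-congˡ (f [] (dots k ++ w)) (sumActive-dots (λ u → f (• ∷ u)) k w)) (sym (+-assoc (f [] (dots k ++ w)) _ _))

sumActive-dots₀ : ∀ f k → sumActive f (dots k) ≡ Σsplit (λ i j → f (dots i) (dots j)) k
sumActive-dots₀ f zero    = refl
sumActive-dots₀ f (suc k) = +-congˡ (f [] (dots k)) (sumActive-dots₀ (λ u → f (• ∷ u)) k)

sumActive-bars : ∀ f k w → sumActive f (bars k ++ w) ≡ sumActive (λ u v → f (bars k ++ u) v) w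
sumActive-bars f zero    w = refl
sumActive-bars f (suc k) w = trans (+-identityˡ _) (sumActive-bars (λ u → f (∣ ∷ u)) k w)

sumActive-bars₀ : ∀ f k → sumActive f (bars k) ≡ + 0
sumActive-bars₀ f zero    = refl
sumActive-bars₀ f (suc k) = trans (+-identityˡ _) (sumActive-bars₀ (λ u → f (∣ ∷ u)) k)

cell-++ : ∀ a s u v → cell a s (u ++ v) ≡ cell a s u ++ v
cell-++ false false u v = refl
cell-++ false true  u v = refl
cell-++ true  s     u v = refl

noAsc-dots : ∀ k → noAsc (dots k) ≡ true
noAsc-dots zero    = refl
noAsc-dots (suc k) = noAsc-dots k

noAsc-dots-++ : ∀ k w → noAsc (dots k ++ w) ≡ noAsc w
noAsc-dots-++ zero    w = refl
noAsc-dots-++ (suc k) w = noAsc-dots-++ k w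

noAsc-bars▲ : ∀ k w → noAsc (bars k ++ ▲ ∷ w) ≡ false
noAsc-bars▲ zero    w = refl
noAsc-bars▲ (suc k) w = refl

noAsc-dots▲ : ∀ k w → noAsc (dots k ++ ▲ ∷ w) ≡ false
noAsc-dots▲ k w = noAsc-dots-++ k (▲ ∷ w)

kill-bars : ∀ p k → kill p (bars k) ≡ bars k
kill-bars p zero    = refl
kill-bars p (suc k) = cong (∣ ∷_) (kill-bars p k)

kill-bars-++ : ∀ p k w → kill p (bars k ++ w) ≡ bars k ++ kill p w
kill-bars-++ p zero    w = refl
kill-bars-++ p (suc k) w = cong (∣ ∷_) (kill-bars-++ p k w)

kill-dots-keep : ∀ k → kill true (dots k) ≡ dots k
kill-dots-keep zero    = refl
kill-dots-keep (suc k) rewrite noAsc-dots k = cong (• ∷_) (kill-dots-keep k)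

kill-false-dots : ∀ k → kill false (dots k) ≡ []
kill-false-dots zero    = refl
kill-false-dots (suc k) = kill-false-dots k

kill-dots-drop : ∀ p k w → noAsc w ≡ false → kill p (dots k ++ w) ≡ kill p w
kill-dots-drop p zero    w asc = refl
kill-dots-drop p (suc k) w asc
  rewrite noAsc-dots-++ k w | asc | ∧-zeroʳ p = kill-dots-drop p k w asc

kill-▲dots : ∀ k → kill true (▲ ∷ dots k) ≡ ▲ ∷ dots k
kill-▲dots k rewrite noAsc-dots k = cong (▲ ∷_) (kill-dots-keep k)

kill-dots▲ : ∀ k b → kill true (dots k ++ ▲ ∷ dots b) ≡ ▲ ∷ dots b
kill-dots▲ k b = trans (kill-dots-drop true k (▲ ∷ dots b) refl) (kill-▲dots b)

-- The permutations avoiding T have the words `dots d`, wE, wF, wF₁ (leftmost site active) and wG, wG₁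
-- (leftmost site inactive). The words without bars, wF a 0 b and wG 0 k 0, need separate treatment:
-- in them an insertion at either ▲ keeps the other ▲ active.
wE : ℕ → ℕ → List Cell
wE a b = dots a ++ ▲ ∷ dots b

wF : ℕ → ℕ → ℕ → List Cell
wF a m b = dots a ++ ▲ ∷ bars m ++ ▲ ∷ dots b

wF₁ : ℕ → ℕ → List Cell
wF₁ m b = bars m ++ ▲ ∷ dots b

wG : ℕ → ℕ → ℕ → List Cell
wG i k j = bars i ++ ▲ ∷ dots k ++ ▲ ∷ bars j

wG₁ : ℕ → ℕ → List Cell
wG₁ i j = bars i ++ ▲ ∷ bars j

-- Amounts to i or j being positive. It is phrased as the test that `kill` performs on the site just
-- after a new maximum, so that rewriting with it deletes this site.
Separated : ℕ → ℕ → Set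
Separated i j = noAsc (bars i) ∧ noAsc (bars j) ≡ false

kill-•bars : ∀ p j → p ∧ noAsc (bars j) ≡ false → kill p (• ∷ bars j) ≡ bars j
kill-•bars p j asc rewrite asc = kill-bars p j

kill-▲bars : ∀ p j → p ∧ noAsc (bars j) ≡ false → kill p (▲ ∷ bars j) ≡ bars (suc j)
kill-▲bars p j asc rewrite asc = cong (∣ ∷_) (kill-bars p j)

kill-wG-init : ∀ i a → kill true (bars i ++ ▲ ∷ dots a) ≡ bars i ++ ▲ ∷ dots a
kill-wG-init i a = trans (kill-bars-++ true i _) (cong (bars i ++_) (kill-▲dots a))

next-G₁ : ∀ i j → Separated i j → next (bars i) (bars j) ≡ wG₁ i j
next-G₁ i j sep = cong₂ (λ u v → u ++ ▲ ∷ v) (kill-bars true i) (kill-•bars _ j sep)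

next-G-first : ∀ i k j → Separated i j → next (bars i) (dots k ++ ▲ ∷ bars j) ≡ wG₁ i (suc j)
next-G-first i k j sep = cong₂ (λ u v → u ++ ▲ ∷ v) (kill-bars true i)
  (trans (kill-dots-drop _ (suc k) (▲ ∷ bars j) refl) (kill-▲bars _ j sep))

next-G-mid : ∀ i a b j → next (bars i ++ ▲ ∷ dots a) (dots b ++ ▲ ∷ bars j) ≡ wG i a (suc j)
next-G-mid i a b j rewrite noAsc-bars▲ i (dots a) = trans
  (cong₂ (λ u v → u ++ ▲ ∷ v) (kill-wG-init i a)
    (trans (kill-dots-drop false (suc b) (▲ ∷ bars j) refl) (kill-▲bars false j refl)))
  (++-assoc (bars i) _ _)

next-G-last : ∀ i k j → next (bars i ++ ▲ ∷ dots k) (bars j) ≡ wG i k j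
next-G-last i k j rewrite noAsc-bars▲ i (dots k) = trans
  (cong₂ (λ u v → u ++ ▲ ∷ v) (kill-wG-init i k) (kill-•bars false j refl))
  (++-assoc (bars i) _ _)

-- Generating functions in x: g · k is (1 − x)⁻ᵏ, z is (1 − 2x)⁻¹ and q is (1 − 2x)⁻¹ − (1 − x)⁻².
g : ℕ → ℕ → ℤ
g zero    k       = + 1
g (suc n) zero    = + 0
g (suc n) (suc k) = g (suc n) k + g n (suc k)

-- The geometric sum x (y + y² + ... + yᵏ) = yᵏ - 1 for y = (1 - x)⁻¹.
Σ-g : ∀ n k → Σ< k (λ i → g n (suc i)) ≡ g (suc n) k
Σ-g n zero    = refl
Σ-g n (suc k) = cong (_+ g n (suc k)) (Σ-g n k)

Σ-g-from : ∀ n c a → Σ< a (λ i → g n (suc (i ℕ.+ c))) ≡ g (suc n) (a ℕ.+ c) - g (suc n) c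
Σ-g-from n c zero    = lem (g (suc n) c)
  where lem : ∀ x → + 0 ≡ x - x
        lem = solve-∀
Σ-g-from n c (suc a) = trans (cong (_+ g n (suc (a ℕ.+ c))) (Σ-g-from n c a)) (lem (g (suc n) (a ℕ.+ c)) _ _)
  where lem : ∀ x y z → x - y + z ≡ x + z - y
        lem = solve-∀

-- The only active site reproduces itself: separation deactivates the site to the right of the new
-- maximum, so there is one continuation at each step.
weight-G₁ : ∀ n i j → Separated i j → weight n false (wG₁ i j) ≡ g n 1
weight-G₁ zero    i j sep = refl
weight-G₁ (suc n) i j sep = begin
  + 0 + sumActive f (wG₁ i j)
    ≡⟨ +-congˡ (+ 0) (sumActive-bars f i _) ⟩
  + 0 + (f (bars i ++ []) (bars j) + sumActive _ (bars j))
    ≡⟨ cong₂ (λ s t → + 0 + (s + t)) child (sumActive-bars₀ _ j) ⟩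
  + 0 + (g n 1 + + 0)
    ≡⟨ +-congˡ (+ 0) (+-identityʳ (g n 1)) ⟩
  + 0 + g n 1 ∎
  where
  f : List Cell → List Cell → ℤ
  f u v = weight n false (next u v)
  child : f (bars i ++ []) (bars j) ≡ g n 1
  child rewrite ++-identityʳ (bars i) | next-G₁ i j sep = weight-G₁ n i j sep

Σ-wG : ∀ i k j (f : List Cell → List Cell → ℤ) → sumActive f (wG i k j) ≡
  f (bars i) (dots k ++ ▲ ∷ bars j)
  + (Σsplit (λ a b → f (bars i ++ ▲ ∷ dots a) (dots b ++ ▲ ∷ bars j)) k
  + f (bars i ++ ▲ ∷ dots k) (bars j))
Σ-wG i k j f = begin
  sumActive f (wG i k j)
    ≡⟨ sumActive-bars f i _ ⟩
  f (bars i ++ []) (dots k ++ ▲ ∷ bars j) + sumActive _ (dots k ++ ▲ ∷ bars j)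
    ≡⟨ cong₂ _+_ (cong (λ u → f u (dots k ++ ▲ ∷ bars j)) (++-identityʳ (bars i)))
         (sumActive-dots _ k _) ⟩
  f (bars i) (dots k ++ ▲ ∷ bars j)
  + (Σsplit (λ a b → f (bars i ++ ▲ ∷ dots a) (dots b ++ ▲ ∷ bars j)) k
  + (f (bars i ++ ▲ ∷ dots k ++ []) (bars j) + sumActive _ (bars j)))
    ≡⟨ cong (λ t → f (bars i) (dots k ++ ▲ ∷ bars j) + (Σsplit (λ a b → f (bars i ++ ▲ ∷ dots a) (dots b ++ ▲ ∷ bars j)) k + t))
         (trans (cong₂ _+_ (cong (λ u → f (bars i ++ ▲ ∷ u) (bars j)) (++-identityʳ (dots k))) (sumActive-bars₀ _ j)) (+-identityʳ _)) ⟩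
  _ ∎

-- The first ▲ leads to a word with one active site, the dots to 2, ..., k + 1 active sites, the
-- last ▲ back to the word itself. Thus S_k = 1 + x (S_1 + ... + S_k) in terms of the number of
-- active sites, and S_k is the k-th power of 1/(1 - x).
weight-G : ∀ n i k j → Separated i j → weight n false (wG i k j) ≡ g n (2 ℕ.+ k)
weight-G zero    i k j sep = refl
weight-G (suc n) i k j sep = begin
  + 0 + sumActive f (wG i k j)
    ≡⟨ +-congˡ (+ 0) (Σ-wG i k j f) ⟩
  + 0 + (f (bars i) (dots k ++ ▲ ∷ bars j)
    + (Σsplit (λ a b → f (bars i ++ ▲ ∷ dots a) (dots b ++ ▲ ∷ bars j)) k
    + f (bars i ++ ▲ ∷ dots k) (bars j)))
    ≡⟨ +-congˡ (+ 0) (cong₂ _+_ first (cong₂ _+_ mid last)) ⟩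
  + 0 + (g n 1 + (Σ< k (λ a → g n (2 ℕ.+ a)) + g n (2 ℕ.+ k)))
    ≡⟨ +-congˡ (+ 0) (sym (+-assoc (g n 1) _ _)) ⟩
  + 0 + (g n 1 + Σ< k (λ a → g n (2 ℕ.+ a)) + g n (2 ℕ.+ k))
    ≡⟨ cong (λ t → + 0 + (t + g n (2 ℕ.+ k))) (sym (Σ<-suc (λ a → g n (suc a)) k)) ⟩
  + 0 + (Σ< (suc k) (λ a → g n (suc a)) + g n (2 ℕ.+ k))
    ≡⟨ +-identityˡ _ ⟩
  Σ< (suc k) (λ a → g n (suc a)) + g n (2 ℕ.+ k)
    ≡⟨ cong (_+ g n (2 ℕ.+ k)) (Σ-g n (suc k)) ⟩
  g (suc n) (2 ℕ.+ k) ∎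
  where
  f : List Cell → List Cell → ℤ
  f u v = weight n false (next u v)
  sep′ : ∀ i j → Separated i (suc j)
  sep′ i j = ∧-zeroʳ (noAsc (bars i))
  first : f (bars i) (dots k ++ ▲ ∷ bars j) ≡ g n 1
  first rewrite next-G-first i k j sep = weight-G₁ n i (suc j) (sep′ i j)
  mid : Σsplit (λ a b → f (bars i ++ ▲ ∷ dots a) (dots b ++ ▲ ∷ bars j)) k ≡ Σ< k (λ a → g n (2 ℕ.+ a))
  mid = Σsplit≡Σ< _ (λ a b → trans (cong (weight n false) (next-G-mid i a b j)) (weight-G n i a (suc j) (sep′ i j))) k
  last : f (bars i ++ ▲ ∷ dots k) (bars j) ≡ g n (2 ℕ.+ k)
  last rewrite next-G-last i k j = weight-G n i k j sep

z q : ℕ → ℤ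
z zero    = + 1
z (suc n) = + 2 * z n
q n = z n - g n 2

h : ℕ → ℕ → ℤ
h n k = q n + g n k

g-1 : ∀ n → g n 1 ≡ + 1
g-1 zero    = refl
g-1 (suc n) = trans (+-identityˡ _) (g-1 n)

g-2 : ∀ n → g (suc n) 2 ≡ + 1 + g n 2
g-2 n = cong (_+ g n 2) (g-1 (suc n))

-- The correction term of `weight-H` and `weight-FL`: two children carry q, and a child with two
-- active sites (`g n 2`) stands where the general rule has one (`g n 1`).
q-suc : ∀ n → q (suc n) ≡ + 2 * q n + g n 2 - g n 1
q-suc n rewrite g-2 n | g-1 n = lem (z n) (g n 2)
  where lem : ∀ x y → + 2 * x - (+ 1 + y) ≡ + 2 * (x - y) + y - + 1
        lem = solve-∀

next-H-first : ∀ k → next [] (dots k ++ ▲ ∷ []) ≡ wG 0 0 0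
next-H-first k = cong (▲ ∷_) (kill-dots-drop true (suc k) (▲ ∷ []) refl)

weight-H : ∀ n k → weight n false (wG 0 k 0) ≡ h n (2 ℕ.+ k)
weight-H zero    k = refl
weight-H (suc n) k = begin
  + 0 + sumActive f (wG 0 k 0)
    ≡⟨ +-congˡ (+ 0) (Σ-wG 0 k 0 f) ⟩
  + 0 + (f [] (dots k ++ ▲ ∷ [])
    + (Σsplit (λ a b → f (▲ ∷ dots a) (dots b ++ ▲ ∷ [])) k + f (▲ ∷ dots k) []))
    ≡⟨ +-congˡ (+ 0) (cong₂ _+_ first (cong₂ _+_ mid last)) ⟩
  + 0 + (h n 2 + (Σ< k (λ a → g n (2 ℕ.+ a)) + h n (2 ℕ.+ k)))
    ≡⟨ lem₁ (q n) (g n 2) (g n 1) (Σ< k (λ a → g n (2 ℕ.+ a))) (g n (2 ℕ.+ k)) ⟩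
  (+ 2 * q n + g n 2 - g n 1) + ((g n 1 + Σ< k (λ a → g n (2 ℕ.+ a))) + g n (2 ℕ.+ k))
    ≡⟨ cong₂ (λ s t → s + (t + g n (2 ℕ.+ k))) (sym (q-suc n)) (trans (sym (Σ<-suc (λ a → g n (suc a)) k)) (Σ-g n (suc k))) ⟩
  h (suc n) (2 ℕ.+ k) ∎
  where
  f : List Cell → List Cell → ℤ
  f u v = weight n false (next u v)
  first : f [] (dots k ++ ▲ ∷ []) ≡ h n 2
  first rewrite next-H-first k = weight-H n 0
  mid : Σsplit (λ a b → f (▲ ∷ dots a) (dots b ++ ▲ ∷ [])) k ≡ Σ< k (λ a → g n (2 ℕ.+ a))
  mid = Σsplit≡Σ< _ (λ a b → trans (cong (weight n false) (next-G-mid 0 a b 0)) (weight-G n 0 a 1 refl)) k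
  last : f (▲ ∷ dots k) [] ≡ h n (2 ℕ.+ k)
  last rewrite next-G-last 0 k 0 = weight-H n k
  lem₁ : ∀ q x y s w → + 0 + (q + x + (s + (q + w))) ≡ (+ 2 * q + x - y) + ((y + s) + w)
  lem₁ = solve-∀

-- Words with active leftmost site and two ascents or a bar

kill-F : ∀ k m b → kill true (dots (suc k) ++ ▲ ∷ bars m ++ ▲ ∷ dots b) ≡ wF₁ (suc m) b
kill-F k m b rewrite kill-dots-drop true (suc k) (▲ ∷ bars m ++ ▲ ∷ dots b) refl | noAsc-bars▲ m (dots b) =
  cong (∣ ∷_) (trans (kill-bars-++ true m _) (cong (bars m ++_) (kill-▲dots b)))

kill-F₁ : ∀ m b → kill true (• ∷ wF₁ m b) ≡ wF₁ m b
kill-F₁ m b rewrite noAsc-bars▲ m (dots b) = trans (kill-bars-++ true m _) (cong (bars m ++_) (kill-▲dots b))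

next-F₁-▲ : ∀ m b → next (bars (suc m)) (dots b) ≡ wG₁ (suc m) 0
next-F₁-▲ m b = cong₂ (λ u v → u ++ ▲ ∷ v) (kill-bars true (suc m)) (kill-false-dots (suc b))

next-F₁-right : ∀ m i j → next (bars m ++ ▲ ∷ dots i) (dots j) ≡ wG m i 0
next-F₁-right m i j rewrite noAsc-bars▲ m (dots i) = trans
  (cong₂ (λ u v → u ++ ▲ ∷ v) (kill-wG-init m i) (kill-false-dots (suc j)))
  (++-assoc (bars m) _ _)

next-F-left : ∀ i j m b → next (dots i) (dots j ++ ▲ ∷ bars m ++ ▲ ∷ dots b) ≡ wF i (suc m) b
next-F-left i j m b rewrite noAsc-dots i = cong₂ (λ u v → u ++ ▲ ∷ v) (kill-dots-keep i) (kill-F j m b)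

next-F-▲ : ∀ a m b → next (dots a) (bars m ++ ▲ ∷ dots b) ≡ wF a m b
next-F-▲ a m b rewrite noAsc-dots a = cong₂ (λ u v → u ++ ▲ ∷ v) (kill-dots-keep a) (kill-F₁ m b)

kill-F-init : ∀ a m i → kill true (dots a ++ ▲ ∷ bars m ++ ▲ ∷ dots i) ≡ bars (suc m) ++ ▲ ∷ dots i
kill-F-init a m i = trans (kill-dots-drop true a (▲ ∷ bars m ++ ▲ ∷ dots i) refl) (lem (noAsc-bars▲ m (dots i)))
  where
  lem : noAsc (bars m ++ ▲ ∷ dots i) ≡ false → kill true (▲ ∷ bars m ++ ▲ ∷ dots i) ≡ bars (suc m) ++ ▲ ∷ dots i
  lem asc rewrite asc = cong (∣ ∷_) (kill-wG-init m i)

next-F-▲▲ : ∀ a m b → next (dots a ++ ▲ ∷ bars (suc m)) (dots b) ≡ wG₁ (2 ℕ.+ m) 0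
next-F-▲▲ a m b rewrite noAsc-dots▲ a (bars (suc m)) = cong₂ (λ u v → u ++ ▲ ∷ v)
  (trans (kill-dots-drop true a (▲ ∷ bars (suc m)) refl) (cong (λ w → ∣ ∷ ∣ ∷ w) (kill-bars true m)))
  (kill-false-dots (suc b))

next-FL-▲▲ : ∀ a b → next (dots a ++ ▲ ∷ []) (dots b) ≡ wG 0 0 0
next-FL-▲▲ a b rewrite noAsc-dots▲ a [] = cong₂ (λ u v → u ++ ▲ ∷ v)
  (kill-dots-drop true a (▲ ∷ []) refl) (kill-false-dots (suc b))

next-F-right : ∀ a m i j → next (dots a ++ ▲ ∷ bars m ++ ▲ ∷ dots i) (dots j) ≡ wG (suc m) i 0
next-F-right a m i j rewrite noAsc-dots▲ a (bars m ++ ▲ ∷ dots i) = trans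
  (cong₂ (λ u v → u ++ ▲ ∷ v) (kill-F-init a m i) (kill-false-dots (suc j)))
  (cong (∣ ∷_) (++-assoc (bars m) _ _))

-- The leftmost insertion reproduces the word. Every other insertion has a bar before it and so
-- deactivates the leftmost site; the ▲ and the dots lead to 1, 2, ..., b + 1 active sites.
weight-F₁ : ∀ n m b → weight n true (wF₁ (suc m) b) ≡ g n (2 ℕ.+ b)
weight-F₁ zero    m b = refl
weight-F₁ (suc n) m b = begin
  weight n true (kill true (• ∷ wF₁ (suc m) b)) + sumActive f (bars (suc m) ++ ▲ ∷ dots b)
    ≡⟨ cong₂ _+_ (trans (cong (weight n true) (kill-F₁ (suc m) b)) (weight-F₁ n m b)) (sumActive-bars f (suc m) _) ⟩
  g n (2 ℕ.+ b) + (f (bars (suc m) ++ []) (dots b) + sumActive _ (dots b))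
    ≡⟨ cong (λ t → g n (2 ℕ.+ b) + t) (cong₂ _+_ onset (trans (sumActive-dots₀ _ b) right)) ⟩
  g n (2 ℕ.+ b) + (g n 1 + Σ< b (λ i → g n (2 ℕ.+ i)))
    ≡⟨ cong (λ t → g n (2 ℕ.+ b) + t) (trans (sym (Σ<-suc (λ a → g n (suc a)) b)) (Σ-g n (suc b))) ⟩
  g n (2 ℕ.+ b) + g (suc n) (suc b)
    ≡⟨ +-comm (g n (2 ℕ.+ b)) _ ⟩
  g (suc n) (2 ℕ.+ b) ∎
  where
  f : List Cell → List Cell → ℤ
  f u v = weight n (noAsc u) (next u v)
  onset : f (bars (suc m) ++ []) (dots b) ≡ g n 1
  onset rewrite ++-identityʳ (bars m) | next-F₁-▲ m b = weight-G₁ n (suc m) 0 refl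
  right : Σsplit (λ i j → f (bars (suc m) ++ ▲ ∷ dots i) (dots j)) b ≡ Σ< b (λ i → g n (2 ℕ.+ i))
  right = Σsplit≡Σ< _ (λ i j → trans (cong (weight n false) (next-F₁-right (suc m) i j)) (weight-G n (suc m) i 0 refl)) b

Σ-wF : ∀ a m b (f : List Cell → List Cell → ℤ) → sumActive f (wF a m b) ≡
  Σsplit (λ i j → f (dots i) (dots j ++ ▲ ∷ bars m ++ ▲ ∷ dots b)) a
  + (f (dots a) (bars m ++ ▲ ∷ dots b)
  + (f (dots a ++ ▲ ∷ bars m) (dots b)
  + Σsplit (λ i j → f (dots a ++ ▲ ∷ bars m ++ ▲ ∷ dots i) (dots j)) b))
Σ-wF a m b f = begin
  sumActive f (wF a m b)
    ≡⟨ sumActive-dots f a _ ⟩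
  Σl + (f (dots a ++ []) (bars m ++ ▲ ∷ dots b) + sumActive (λ u v → f (dots a ++ ▲ ∷ u) v) (bars m ++ ▲ ∷ dots b))
    ≡⟨ cong₂ (λ s t → Σl + (s + t)) (cong (λ u → f u (bars m ++ ▲ ∷ dots b)) (++-identityʳ (dots a)))
         (sumActive-bars _ m _) ⟩
  Σl + (f (dots a) (bars m ++ ▲ ∷ dots b) + (f (dots a ++ ▲ ∷ bars m ++ []) (dots b) + sumActive _ (dots b)))
    ≡⟨ cong₂ (λ s t → Σl + (f (dots a) (bars m ++ ▲ ∷ dots b) + (s + t)))
         (cong (λ u → f (dots a ++ ▲ ∷ u) (dots b)) (++-identityʳ (bars m))) (sumActive-dots₀ _ b) ⟩
  _ ∎
  where
  Σl : ℤ
  Σl = Σsplit (λ i j → f (dots i) (dots j ++ ▲ ∷ bars m ++ ▲ ∷ dots b)) a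

-- Again each number from 1 to a + b + 3 occurs once: the second ▲ gives 1, the dots after it 2,
-- ..., b + 1, the leftmost site b + 2, the dots before the first ▲ b + 3, ..., a + b + 2, and the
-- first ▲ gives the word itself.
weight-F : ∀ n a m b → weight n true (wF a (suc m) b) ≡ g n (suc (a ℕ.+ (2 ℕ.+ b)))
weight-F zero    a m b = refl
weight-F (suc n) a m b = begin
  weight n true (kill true (dots (suc a) ++ ▲ ∷ bars (suc m) ++ ▲ ∷ dots b)) + sumActive f (wF a (suc m) b)
    ≡⟨ cong₂ _+_ (trans (cong (weight n true) (kill-F a (suc m) b)) (weight-F₁ n (suc m) b)) (Σ-wF a (suc m) b f) ⟩
  g n (2 ℕ.+ b) + (Σsplit (λ i j → f (dots i) (dots j ++ ▲ ∷ bars (suc m) ++ ▲ ∷ dots b)) a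
  + (f (dots a) (bars (suc m) ++ ▲ ∷ dots b)
  + (f (dots a ++ ▲ ∷ bars (suc m)) (dots b)
  + Σsplit (λ i j → f (dots a ++ ▲ ∷ bars (suc m) ++ ▲ ∷ dots i) (dots j)) b)))
    ≡⟨ cong (λ t → g n (2 ℕ.+ b) + t) (cong₂ _+_ left (cong₂ _+_ onset₁ (cong₂ _+_ onset₂ right))) ⟩
  g n (2 ℕ.+ b) + (Σ< a (λ i → g n (suc (i ℕ.+ (2 ℕ.+ b)))) + (g n (suc (a ℕ.+ (2 ℕ.+ b))) + (g n 1 + Σ< b (λ i → g n (2 ℕ.+ i)))))
    ≡⟨ cong₂ (λ s t → g n (2 ℕ.+ b) + (s + (g n (suc (a ℕ.+ (2 ℕ.+ b))) + t))) (Σ-g-from n (2 ℕ.+ b) a)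
       (trans (sym (Σ<-suc (λ a → g n (suc a)) b)) (Σ-g n (suc b))) ⟩
  g n (2 ℕ.+ b) + ((g (suc n) (a ℕ.+ (2 ℕ.+ b)) - (g (suc n) (suc b) + g n (2 ℕ.+ b))) + (g n (suc (a ℕ.+ (2 ℕ.+ b))) + g (suc n) (suc b)))
    ≡⟨ lem (g n (2 ℕ.+ b)) (g (suc n) (a ℕ.+ (2 ℕ.+ b))) (g (suc n) (suc b)) (g n (suc (a ℕ.+ (2 ℕ.+ b)))) ⟩
  g (suc n) (suc (a ℕ.+ (2 ℕ.+ b))) ∎
  where
  f : List Cell → List Cell → ℤ
  f u v = weight n (noAsc u) (next u v)
  left : Σsplit (λ i j → f (dots i) (dots j ++ ▲ ∷ bars (suc m) ++ ▲ ∷ dots b)) a ≡ Σ< a (λ i → g n (suc (i ℕ.+ (2 ℕ.+ b))))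
  left = Σsplit≡Σ< _ (λ i j → trans (cong₂ (weight n) (noAsc-dots i) (next-F-left i j (suc m) b)) (weight-F n i (suc m) b)) a
  onset₁ : f (dots a) (bars (suc m) ++ ▲ ∷ dots b) ≡ g n (suc (a ℕ.+ (2 ℕ.+ b)))
  onset₁ = trans (cong₂ (weight n) (noAsc-dots a) (next-F-▲ a (suc m) b)) (weight-F n a m b)
  onset₂ : f (dots a ++ ▲ ∷ bars (suc m)) (dots b) ≡ g n 1
  onset₂ = trans (cong₂ (weight n) (noAsc-dots▲ a _) (next-F-▲▲ a m b)) (weight-G₁ n (2 ℕ.+ m) 0 refl)
  right : Σsplit (λ i j → f (dots a ++ ▲ ∷ bars (suc m) ++ ▲ ∷ dots i) (dots j)) b ≡ Σ< b (λ i → g n (2 ℕ.+ i))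
  right = Σsplit≡Σ< _ (λ i j → trans (cong₂ (weight n) (noAsc-dots▲ a _) (next-F-right a (suc m) i j)) (weight-G n (2 ℕ.+ m) i 0 refl)) b
  lem : ∀ x y z w → x + ((y - (z + x)) + (w + z)) ≡ y + w
  lem = solve-∀

-- As in `weight-F`, except that the first ▲ reproduces a word without bars and the second ▲ leads
-- to `wG 0 0 0`. These two children account for the recurrence of q.
weight-FL : ∀ n a b → weight n true (wF a 0 b) ≡ h n (suc (a ℕ.+ (2 ℕ.+ b)))
weight-FL zero    a b = refl
weight-FL (suc n) a b = begin
  weight n true (kill true (dots (suc a) ++ ▲ ∷ ▲ ∷ dots b)) + sumActive f (wF a 0 b)
    ≡⟨ cong₂ _+_ (trans (cong (weight n true) (kill-F a 0 b)) (weight-F₁ n 0 b)) (Σ-wF a 0 b f) ⟩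
  g n (2 ℕ.+ b) + (Σsplit (λ i j → f (dots i) (dots j ++ ▲ ∷ ▲ ∷ dots b)) a
  + (f (dots a) (▲ ∷ dots b)
  + (f (dots a ++ ▲ ∷ []) (dots b)
  + Σsplit (λ i j → f (dots a ++ ▲ ∷ ▲ ∷ dots i) (dots j)) b)))
    ≡⟨ cong (λ t → g n (2 ℕ.+ b) + t) (cong₂ _+_ left (cong₂ _+_ onset₁ (cong₂ _+_ onset₂ right))) ⟩
  g n (2 ℕ.+ b) + (Σ< a (λ i → g n (suc (i ℕ.+ (2 ℕ.+ b)))) + (h n (suc (a ℕ.+ (2 ℕ.+ b))) + (h n 2 + Σ< b (λ i → g n (2 ℕ.+ i)))))
    ≡⟨ cong (λ s → g n (2 ℕ.+ b) + (s + (h n (suc (a ℕ.+ (2 ℕ.+ b))) + (h n 2 + Σ< b (λ i → g n (2 ℕ.+ i)))))) (Σ-g-from n (2 ℕ.+ b) a) ⟩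
  g n (2 ℕ.+ b) + ((g (suc n) (a ℕ.+ (2 ℕ.+ b)) - (g (suc n) (suc b) + g n (2 ℕ.+ b)))
    + (h n (suc (a ℕ.+ (2 ℕ.+ b))) + (h n 2 + Σ< b (λ i → g n (2 ℕ.+ i)))))
    ≡⟨ cong (λ s → g n (2 ℕ.+ b) + ((g (suc n) (a ℕ.+ (2 ℕ.+ b)) - (s + g n (2 ℕ.+ b)))
         + (h n (suc (a ℕ.+ (2 ℕ.+ b))) + (h n 2 + Σ< b (λ i → g n (2 ℕ.+ i))))))
       (sym (trans (sym (Σ<-suc (λ a → g n (suc a)) b)) (Σ-g n (suc b)))) ⟩
  g n (2 ℕ.+ b) + ((g (suc n) (a ℕ.+ (2 ℕ.+ b)) - ((g n 1 + Σ< b (λ i → g n (2 ℕ.+ i))) + g n (2 ℕ.+ b)))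
    + (h n (suc (a ℕ.+ (2 ℕ.+ b))) + (h n 2 + Σ< b (λ i → g n (2 ℕ.+ i)))))
    ≡⟨ lem (q n) (g n 2) (g n 1) (g n (2 ℕ.+ b)) (g (suc n) (a ℕ.+ (2 ℕ.+ b))) (Σ< b (λ i → g n (2 ℕ.+ i))) (g n (suc (a ℕ.+ (2 ℕ.+ b)))) ⟩
  (+ 2 * q n + g n 2 - g n 1) + (g (suc n) (a ℕ.+ (2 ℕ.+ b)) + g n (suc (a ℕ.+ (2 ℕ.+ b))))
    ≡⟨ cong (_+ g (suc n) (suc (a ℕ.+ (2 ℕ.+ b)))) (sym (q-suc n)) ⟩
  h (suc n) (suc (a ℕ.+ (2 ℕ.+ b))) ∎
  where
  f : List Cell → List Cell → ℤ
  f u v = weight n (noAsc u) (next u v)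
  left : Σsplit (λ i j → f (dots i) (dots j ++ ▲ ∷ ▲ ∷ dots b)) a ≡ Σ< a (λ i → g n (suc (i ℕ.+ (2 ℕ.+ b))))
  left = Σsplit≡Σ< _ (λ i j → trans (cong₂ (weight n) (noAsc-dots i) (next-F-left i j 0 b)) (weight-F n i 0 b)) a
  onset₁ : f (dots a) (▲ ∷ dots b) ≡ h n (suc (a ℕ.+ (2 ℕ.+ b)))
  onset₁ = trans (cong₂ (weight n) (noAsc-dots a) (next-F-▲ a 0 b)) (weight-FL n a b)
  onset₂ : f (dots a ++ ▲ ∷ []) (dots b) ≡ h n 2
  onset₂ = trans (cong₂ (weight n) (noAsc-dots▲ a _) (next-FL-▲▲ a b)) (weight-H n 0)
  right : Σsplit (λ i j → f (dots a ++ ▲ ∷ ▲ ∷ dots i) (dots j)) b ≡ Σ< b (λ i → g n (2 ℕ.+ i))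
  right = Σsplit≡Σ< _ (λ i j → trans (cong₂ (weight n) (noAsc-dots▲ a _) (next-F-right a 0 i j)) (weight-G n 1 i 0 refl)) b
  lem : ∀ q x y v G s w → v + ((G - ((y + s) + v)) + ((q + w) + ((q + x) + s))) ≡ (+ 2 * q + x - y) + (G + w)
  lem = solve-∀

-- Generating functions of words

-- If s has generating function S(x), then pascal s · b has generating function S(x) (1 − x)⁻ᵇ.
pascal : (ℕ → ℤ) → ℕ → ℕ → ℤ
pascal s zero    b       = s 0
pascal s (suc n) zero    = s (suc n)
pascal s (suc n) (suc b) = pascal s (suc n) b + pascal s n (suc b)

pascal-0 : ∀ s n → pascal s n 0 ≡ s n
pascal-0 s zero    = refl
pascal-0 s (suc n) = refl

pascal-1 : ∀ s (t : ℕ → ℤ) → t 0 ≡ s 0 → (∀ n → t (suc n) ≡ s (suc n) + t n) → ∀ n → pascal s n 1 ≡ t n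
pascal-1 s t t₀ t₊ zero    = sym t₀
pascal-1 s t t₀ t₊ (suc n) = trans (+-congˡ (s (suc n)) (pascal-1 s t t₀ t₊ n)) (sym (t₊ n))

-- Reduces an identity for all b to the case b = 0: both sides obey Pascal's rule, whose edge case
-- involves the constant row `s 0`. It plays the part of multiplying an identity of power series by
-- (1 - x)⁻ᵇ.
pascal-unique : ∀ s (L : ℕ → ℕ → ℤ) → (∀ n → s (suc n) ≡ L n 0)
  → (∀ b → L 0 (suc b) ≡ L 0 b + s 0)
  → (∀ n b → L (suc n) (suc b) ≡ L (suc n) b + L n (suc b))
  → ∀ n b → pascal s (suc n) b ≡ L n b
pascal-unique s L s₊ L₀ L₊ n       zero    = s₊ n
pascal-unique s L s₊ L₀ L₊ zero    (suc b) =
  trans (cong (_+ s 0) (pascal-unique s L s₊ L₀ L₊ 0 b)) (sym (L₀ b))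
pascal-unique s L s₊ L₀ L₊ (suc n) (suc b) =
  trans (cong₂ _+_ (pascal-unique s L s₊ L₀ L₊ (suc n) b) (pascal-unique s L s₊ L₀ L₊ n (suc b))) (sym (L₊ n b))

Σ-pascal : ∀ s n d → Σ< d (λ j → pascal s n (suc j)) ≡ pascal s (suc n) d - s (suc n)
Σ-pascal s n zero    = lem (s (suc n))
  where lem : ∀ x → + 0 ≡ x - x
        lem = solve-∀
Σ-pascal s n (suc d) = trans (cong (_+ pascal s n (suc d)) (Σ-pascal s n d)) (lem (pascal s (suc n) d) _ _)
  where lem : ∀ x y z → x - y + z ≡ x + z - y
        lem = solve-∀

-- With y = (1 − x)⁻¹, the word wE a b has generating function α yᵇ + z yᵃ⁺ᵇ⁺¹ + γ b + δ (a + 1) + ε.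
-- The sequences zy and αy are the products of z and α with y; the factor 1 − 3x + x² enters through
-- the two summands α and αy in the recurrence of α.
zy : ℕ → ℤ
zy n = + 2 * z n - + 1

α αy γ δ ε : ℕ → ℤ
α zero     = + 0
α (suc n)  = α n + αy n + zy n - g n 2
αy zero    = + 0
αy (suc n) = α (suc n) + αy n
γ zero     = + 0
γ (suc n)  = + 2 * γ n + q n
δ zero     = + 0
δ (suc n)  = δ n + q n
ε zero     = + 0
ε (suc n)  = + 2 * ε n + δ n + γ n - q n - + 1

pascal-z-1 : ∀ n → pascal z n 1 ≡ zy n
pascal-z-1 = pascal-1 z zy refl (λ n → lem (z n))
  where lem : ∀ x → + 2 * (+ 2 * x) - + 1 ≡ + 2 * x + (+ 2 * x - + 1)
        lem = solve-∀

pascal-α-1 : ∀ n → pascal α n 1 ≡ αy n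
pascal-α-1 = pascal-1 α αy refl (λ n → refl)

-- For power series this is z = x z y + y multiplied by yᶜ, where y = 1/(1 - x).
pascal-z : ∀ n c → pascal z (suc n) c ≡ pascal z n (suc c) + g (suc n) (suc c)
pascal-z = pascal-unique z (λ n c → pascal z n (suc c) + g (suc n) (suc c)) base (λ b → sym (+-assoc (+ 1) (g 1 (suc b)) (+ 1)))
  (λ n b → lem (pascal z (suc n) (suc b)) (pascal z n (suc (suc b))) (g (suc (suc n)) (suc b)) (g (suc n) (suc (suc b))))
  where
  base : ∀ n → z (suc n) ≡ pascal z n 1 + g (suc n) 1
  base n rewrite pascal-z-1 n | g-1 (suc n) = lem₀ (z n)
    where lem₀ : ∀ x → + 2 * x ≡ + 2 * x - + 1 + + 1
          lem₀ = solve-∀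
  lem : ∀ x y u v → x + y + (u + v) ≡ x + u + (y + v)
  lem = solve-∀

-- The recurrence of α multiplied by (1 - x)⁻ᵇ. The final difference equals - `g n (2 ℕ.+ b)`; it is
-- kept as two terms because the sums over the dots in `weight-E` yield these.
pascal-α : ∀ n b → pascal α (suc n) b ≡
  pascal α n b + pascal α n (suc b) + pascal z n (suc b) + (g (suc n) (suc b) - g (suc n) (2 ℕ.+ b))
pascal-α = pascal-unique α _ base (λ b → lem₁ (g 1 (suc b)))
  (λ n b → lem₂ (pascal α (suc n) b) (pascal α n (suc b)) (pascal α n (2 ℕ.+ b)) (pascal z (suc n) (suc b))
    (pascal z n (2 ℕ.+ b)) (g (2 ℕ.+ n) (suc b)) (g (suc n) (2 ℕ.+ b)) (g (suc n) (3 ℕ.+ b)))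
  where
  base : ∀ n → α (suc n) ≡ pascal α n 0 + pascal α n 1 + pascal z n 1 + (g (suc n) 1 - g (suc n) 2)
  base n rewrite pascal-0 α n | pascal-α-1 n | pascal-z-1 n | g-2 n | g-1 (suc n) = lem₀ (α n) (αy n) (zy n) (g n 2)
    where lem₀ : ∀ x y z u → x + y + z - u ≡ x + y + z + (+ 1 - (+ 1 + u))
          lem₀ = solve-∀
  lem₁ : ∀ x → + 0 + + 0 + + 1 + (x + + 1 - (x + + 1 + + 1)) ≡ + 0 + + 0 + + 1 + (x - (x + + 1)) + + 0
  lem₁ = solve-∀
  lem₂ : ∀ α₁ α₂ α₃ z₁ z₂ u v w →
    (α₁ + α₂) + ((α₁ + α₂) + α₃) + (z₁ + z₂) + ((u + v) - ((u + v) + w))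
    ≡ (α₁ + (α₁ + α₂) + z₁ + (u - (u + v))) + (α₂ + α₃ + z₂ + (v - w))
  lem₂ = solve-∀

Σ-h-from : ∀ n c a → Σ< a (λ i → h n (suc (i ℕ.+ c))) ≡ + a * q n + (g (suc n) (a ℕ.+ c) - g (suc n) c)
Σ-h-from n c zero    = lem (q n) (g (suc n) c)
  where lem : ∀ q x → + 0 ≡ + 0 * q + (x - x)
        lem = solve-∀
Σ-h-from n c (suc a) = trans (cong (_+ h n (suc (a ℕ.+ c))) (Σ-h-from n c a))
  (lem (+ a) (q n) (g (suc n) (a ℕ.+ c)) _ _)
  where lem : ∀ a q x y z → a * q + (x - y) + (q + z) ≡ (+ 1 + a) * q + (x + z - y)
        lem = solve-∀

Σ-h : ∀ n b → Σ< b (λ i → h n (2 ℕ.+ i)) ≡ + b * q n + (g (suc n) (suc b) - + 1)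
Σ-h n zero = trans (lem (q n)) (cong (λ x → + 0 * q n + (x - + 1)) (sym (g-1 (suc n))))
  where lem : ∀ q → + 0 ≡ + 0 * q + (+ 1 - + 1)
        lem = solve-∀
Σ-h n (suc b) = trans (cong (_+ h n (2 ℕ.+ b)) (Σ-h n b)) (lem (+ b) (q n) (g (suc n) (suc b)) _ _)
  where lem : ∀ a q x y z → a * q + (x - y) + (q + z) ≡ (+ 1 + a) * q + (x + z - y)
        lem = solve-∀

-- Continuations of the words with one ascent

E-value : ℕ → ℕ → ℕ → ℤ
E-value n a b = pascal α n b + pascal z n (suc (a ℕ.+ b)) + γ n * + b + δ n * + suc a + ε n

next-E-left : ∀ i j b → next (dots i) (dots j ++ ▲ ∷ dots b) ≡ wF i 0 b
next-E-left i j b rewrite noAsc-dots i = cong₂ (λ u v → u ++ ▲ ∷ v) (kill-dots-keep i) (kill-dots▲ (suc j) b)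

next-dots : ∀ i j → next (dots i) (dots j) ≡ wE i (suc j)
next-dots i j rewrite noAsc-dots i = cong₂ (λ u v → u ++ ▲ ∷ v) (kill-dots-keep i) (kill-dots-keep (suc j))

next-E-right : ∀ a i j → next (dots a ++ ▲ ∷ dots i) (dots j) ≡ wG 0 i 0
next-E-right a i j rewrite noAsc-dots▲ a (dots i) = cong₂ (λ u v → u ++ ▲ ∷ v) (kill-dots▲ a i) (kill-false-dots (suc j))

-- The leftmost insertion sends (a, b) to (0, b), an insertion at ▲ to (a, b + 1). Both children
-- contribute to the α part and to 2γ and 2ε. The part depending on a passes only to the second
-- child, which gives `pascal-z` and the recurrence of δ; at the first child the z part no longer
-- depends on a and feeds α.
weight-E : ∀ n a b → weight n true (wE a b) ≡ E-value n a b
weight-E zero    a b = lem (+ b) (+ suc a)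
  where lem : ∀ x y → + 1 ≡ + 0 + + 1 + + 0 * x + + 0 * y + + 0
        lem = solve-∀
weight-E (suc n) a b = begin
  weight n true (kill true (dots (suc a) ++ ▲ ∷ dots b)) + sumActive f (wE a b)
    ≡⟨ cong₂ _+_ (trans (cong (weight n true) (kill-dots▲ (suc a) b)) (weight-E n 0 b)) (sumActive-dots f a _) ⟩
  E-value n 0 b + (Σsplit (λ i j → f (dots i) (dots j ++ ▲ ∷ dots b)) a
    + (f (dots a ++ []) (dots b) + sumActive (λ u v → f (dots a ++ ▲ ∷ u) v) (dots b)))
    ≡⟨ cong₂ (λ s t → E-value n 0 b + (s + t)) left (cong₂ _+_ onset (trans (sumActive-dots₀ _ b) right)) ⟩
  E-value n 0 b + (Σ< a (λ i → h n (suc (i ℕ.+ (2 ℕ.+ b)))) + (E-value n a (suc b) + Σ< b (λ i → h n (2 ℕ.+ i))))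
    ≡⟨ cong₂ (λ s t → E-value n 0 b + (s + (E-value n a (suc b) + t))) (Σ-h-from n (2 ℕ.+ b) a) (Σ-h n b) ⟩
  E-value n 0 b + ((+ a * q n + (g (suc n) (a ℕ.+ (2 ℕ.+ b)) - g (suc n) (2 ℕ.+ b)))
    + (E-value n a (suc b) + (+ b * q n + (g (suc n) (suc b) - + 1))))
    ≡⟨ cong₂ (λ i j → E-value n 0 b + ((+ a * q n + (g (suc n) i - g (suc n) (2 ℕ.+ b)))
         + ((pascal α n (suc b) + pascal z n (suc j) + γ n * + suc b + δ n * + suc a + ε n) + (+ b * q n + (g (suc n) (suc b) - + 1)))))
         (trans (ℕ.+-suc a (suc b)) (cong suc (ℕ.+-suc a b))) (ℕ.+-suc a b) ⟩
  _
    ≡⟨ lem (pascal α n b) (pascal α n (suc b)) (pascal z n (suc b)) (pascal z n (2 ℕ.+ (a ℕ.+ b))) (g (suc n) (2 ℕ.+ (a ℕ.+ b)))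
         (g (suc n) (2 ℕ.+ b)) (g (suc n) (suc b)) (γ n) (δ n) (ε n) (q n) (+ a) (+ b) ⟩
  (pascal α n b + pascal α n (suc b) + pascal z n (suc b) + (g (suc n) (suc b) - g (suc n) (2 ℕ.+ b)))
    + (pascal z n (2 ℕ.+ (a ℕ.+ b)) + g (suc n) (2 ℕ.+ (a ℕ.+ b)))
    + γ (suc n) * + b + δ (suc n) * + suc a + ε (suc n)
    ≡⟨ cong₂ (λ s t → s + t + γ (suc n) * + b + δ (suc n) * + suc a + ε (suc n))
         (sym (pascal-α n b)) (sym (pascal-z n (suc (a ℕ.+ b)))) ⟩
  E-value (suc n) a b ∎
  where
  f : List Cell → List Cell → ℤ
  f u v = weight n (noAsc u) (next u v)
  left : Σsplit (λ i j → f (dots i) (dots j ++ ▲ ∷ dots b)) a ≡ Σ< a (λ i → h n (suc (i ℕ.+ (2 ℕ.+ b))))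
  left = Σsplit≡Σ< _ (λ i j → trans (cong₂ (weight n) (noAsc-dots i) (next-E-left i j b)) (weight-FL n i b)) a
  onset : f (dots a ++ []) (dots b) ≡ E-value n a (suc b)
  onset rewrite ++-identityʳ (dots a) = trans (cong₂ (weight n) (noAsc-dots a) (next-dots a b)) (weight-E n a (suc b))
  right : Σsplit (λ i j → f (dots a ++ ▲ ∷ dots i) (dots j)) b ≡ Σ< b (λ i → h n (2 ℕ.+ i))
  right = Σsplit≡Σ< _ (λ i j → trans (cong₂ (weight n) (noAsc-dots▲ a _) (next-E-right a i j)) (weight-H n i)) b
  lem : ∀ α₀ α₁ z₁ z₂ ga g₂ g₁ γ δ ε q a b →
    (α₀ + z₁ + γ * b + δ * + 1 + ε) + ((a * q + (ga - g₂)) + ((α₁ + z₂ + γ * (+ 1 + b) + δ * (+ 1 + a) + ε) + (b * q + (g₁ - + 1))))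
    ≡ (α₀ + α₁ + z₁ + (g₁ - g₂)) + (z₂ + ga) + (+ 2 * γ + q) * b + (δ + q) * (+ 1 + a) + (+ 2 * ε + δ + γ - q - + 1)
  lem = solve-∀

-- The word `dots d` has generating function A yᵈ + B d yᵈ + C d(d+1)/2 + F d + K.
B By A Ay C F K : ℕ → ℤ
B zero     = + 0
B (suc n)  = By n + zy n
By zero    = + 0
By (suc n) = B (suc n) + By n
A zero     = + 0
A (suc n)  = Ay n + By n + α (suc n)
Ay zero    = + 0
Ay (suc n) = A (suc n) + Ay n
C zero     = + 0
C (suc n)  = C n + γ n + δ n
F zero     = + 0
F (suc n)  = F n + C n + ε n
K zero     = + 1
K (suc n)  = K n + C n + F n - α (suc n)

pascal-B : ∀ n d → pascal B (suc n) d ≡ pascal B n (suc d) + pascal z n (suc d)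
pascal-B = pascal-unique B _ base (λ b → refl)
  (λ n b → lem (pascal B (suc n) (suc b)) (pascal B n (2 ℕ.+ b)) (pascal z (suc n) (suc b)) (pascal z n (2 ℕ.+ b)))
  where
  base : ∀ n → B (suc n) ≡ pascal B n 1 + pascal z n 1
  base n rewrite pascal-z-1 n | pascal-1 B By refl (λ n → refl) n = refl
  lem : ∀ x y u v → x + y + (u + v) ≡ x + u + (y + v)
  lem = solve-∀

pascal-A : ∀ n d → pascal A (suc n) d ≡ pascal A n (suc d) + pascal B n (suc d) + pascal α (suc n) d
pascal-A = pascal-unique A _ base (λ b → sym (+-assoc (+ 0) (pascal α 1 b) (+ 0)))
  (λ n b → lem (pascal A (suc n) (suc b)) (pascal A n (2 ℕ.+ b)) (pascal B (suc n) (suc b)) (pascal B n (2 ℕ.+ b))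
               (pascal α (2 ℕ.+ n) b) (pascal α (suc n) (suc b)))
  where
  base : ∀ n → A (suc n) ≡ pascal A n 1 + pascal B n 1 + α (suc n)
  base n rewrite pascal-1 A Ay refl (λ n → refl) n | pascal-1 B By refl (λ n → refl) n = refl
  lem : ∀ x y u v s t → (x + y) + (u + v) + (s + t) ≡ (x + u + s) + (y + v + t)
  lem = solve-∀

tri : ℕ → ℤ
tri zero    = + 0
tri (suc d) = tri d + + suc d

-- The offset s carries the induction, since removing the first term raises every i by one. As i + j
-- is constant, all the z terms coincide; this is why the solution for `dots d` needs a summand d
-- yᵈ.
Σ-E-value : ∀ n s d → Σsplit (λ i j → E-value n (s ℕ.+ i) (suc j)) d ≡
  Σ< d (λ j → pascal α n (suc j)) + + d * pascal z n (suc (s ℕ.+ d)) + (γ n + δ n) * tri d + (δ n * + s + ε n) * + d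
Σ-E-value n s zero    = lem (pascal z n (suc (s ℕ.+ 0))) (γ n + δ n) (δ n * + s + ε n)
  where lem : ∀ x y w → + 0 ≡ + 0 + + 0 * x + y * + 0 + w * + 0
        lem = solve-∀
Σ-E-value n s (suc d) = begin
  E-value n (s ℕ.+ 0) (suc d) + Σsplit (λ i j → E-value n (s ℕ.+ suc i) (suc j)) d
    ≡⟨ cong₂ (λ x y → E-value n x (suc d) + y) (ℕ.+-identityʳ s)
         (trans (Σsplit-cong (λ i j → cong (λ x → E-value n x (suc j)) (ℕ.+-suc s i)) d) (Σ-E-value n (suc s) d)) ⟩
  E-value n s (suc d) + (Σα + + d * pascal z n (suc (suc s ℕ.+ d)) + (γ n + δ n) * tri d + (δ n * + suc s + ε n) * + d)
    ≡⟨ cong (λ x → E-value n s (suc d) + (Σα + + d * pascal z n (suc x) + (γ n + δ n) * tri d + (δ n * + suc s + ε n) * + d))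
         (sym (ℕ.+-suc s d)) ⟩
  _
    ≡⟨ lem (pascal α n (suc d)) (pascal z n (suc (s ℕ.+ suc d))) (γ n) (δ n) (ε n) (+ d) (+ s) Σα (tri d) ⟩
  _ ∎
  where
  Σα : ℤ
  Σα = Σ< d (λ j → pascal α n (suc j))
  lem : ∀ α₁ z₁ γ δ ε d s Σα t →
    (α₁ + z₁ + γ * (+ 1 + d) + δ * (+ 1 + s) + ε) + (Σα + d * z₁ + (γ + δ) * t + (δ * (+ 1 + s) + ε) * d)
    ≡ (Σα + α₁) + (+ 1 + d) * z₁ + (γ + δ) * (t + (+ 1 + d)) + (δ * s + ε) * (+ 1 + d)
  lem = solve-∀

D-value : ℕ → ℕ → ℤ
D-value n d = pascal A n d + + d * pascal B n d + C n * tri d + F n * + d + K n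

-- By `Σ-pascal` the α terms of the children telescope to α yᵈ - α. The first half enters the
-- recurrence of A, the second that of K.
weight-D : ∀ n d → weight n true (dots d) ≡ D-value n d
weight-D zero    d = lem (+ d) (tri d)
  where lem : ∀ x y → + 1 ≡ + 0 + x * + 0 + + 0 * y + + 0 * x + + 1
        lem = solve-∀
weight-D (suc n) d = begin
  weight n true (kill true (dots (suc d))) + sumActive f (dots d)
    ≡⟨ cong₂ _+_ (trans (cong (weight n true) (kill-dots-keep (suc d))) (weight-D n (suc d))) (trans (sumActive-dots₀ f d) child) ⟩
  D-value n (suc d) + Σsplit (λ i j → E-value n i (suc j)) d
    ≡⟨ cong (λ t → D-value n (suc d) + t) (Σ-E-value n 0 d) ⟩
  D-value n (suc d) + (Σ< d (λ j → pascal α n (suc j)) + + d * pascal z n (suc d) + (γ n + δ n) * tri d + (δ n * + 0 + ε n) * + d)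
    ≡⟨ cong (λ t → D-value n (suc d) + (t + + d * pascal z n (suc d) + (γ n + δ n) * tri d + (δ n * + 0 + ε n) * + d)) (Σ-pascal α n d) ⟩
  D-value n (suc d) + (pascal α (suc n) d - α (suc n) + + d * pascal z n (suc d) + (γ n + δ n) * tri d + (δ n * + 0 + ε n) * + d)
    ≡⟨ lem (pascal A n (suc d)) (pascal B n (suc d)) (C n) (tri d) (F n) (K n) (pascal α (suc n) d) (α (suc n)) (pascal z n (suc d)) (γ n) (δ n) (ε n) (+ d) ⟩
  (pascal A n (suc d) + pascal B n (suc d) + pascal α (suc n) d) + + d * (pascal B n (suc d) + pascal z n (suc d))
    + C (suc n) * tri d + F (suc n) * + d + K (suc n)
    ≡⟨ cong₂ (λ s t → s + + d * t + C (suc n) * tri d + F (suc n) * + d + K (suc n)) (sym (pascal-A n d)) (sym (pascal-B n d)) ⟩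
  D-value (suc n) d ∎
  where
  f : List Cell → List Cell → ℤ
  f u v = weight n (noAsc u) (next u v)
  child : Σsplit (λ i j → f (dots i) (dots j)) d ≡ Σsplit (λ i j → E-value n i (suc j)) d
  child = Σsplit-cong (λ i j → trans (cong₂ (weight n) (noAsc-dots i) (next-dots i j)) (weight-E n i (suc j))) d
  lem : ∀ A B C t F K α₀ α₁ z γ δ ε d →
    (A + (+ 1 + d) * B + C * (t + (+ 1 + d)) + F * (+ 1 + d) + K) + (α₀ - α₁ + d * z + (γ + δ) * t + (δ * + 0 + ε) * d)
    ≡ (A + B + α₀) + d * (B + z) + (C + γ + δ) * t + (F + C + ε) * d + (K + C + F - α₁)
  lem = solve-∀

avoiders : ℕ → ℤ
avoiders n = A n + K n

weight-root : ∀ n → weight n true [] ≡ avoiders n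
weight-root n = trans (weight-D n 0) (trans (cong (λ x → x + + 0 * pascal B n 0 + C n * + 0 + F n * + 0 + K n) (pascal-0 A n))
  (lem (A n) (pascal B n 0) (C n) (F n) (K n)))
  where lem : ∀ A B C F K → A + + 0 * B + C * + 0 + F * + 0 + K ≡ A + K
        lem = solve-∀

-- The linear recurrence

-- The summation bound j is independent of n, as in the recursion inside `convCoeff`; this also
-- permits cutting the sum at the degree of the denominator.
partialConv : Poly → (ℕ → ℤ) → ℕ → ℕ → ℤ
partialConv P s n zero    = coeff P 0 * s n
partialConv P s n (suc j) = partialConv P s n j + coeff P (suc j) * s (n ℕ.∸ suc j)

partialConv-cong : ∀ P {s t} → (∀ m → s m ≡ t m) → ∀ n j → partialConv P s n j ≡ partialConv P t n j
partialConv-cong P s≗t n zero    = cong (coeff P 0 *_) (s≗t n)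
partialConv-cong P s≗t n (suc j) =
  cong₂ (λ x y → x + coeff P (suc j) * y) (partialConv-cong P s≗t n j) (s≗t _)

mutual
  convCoeff≡partialConv : ∀ P a n → convCoeff P a n ≡ partialConv P (λ m → + a m) n n
  convCoeff≡partialConv P a zero    = refl
  -- The recursion inside convCoeff is a local function and cannot be named. Abstracting _+_ and suc m
  -- leaves it in a rigid position, with distinct variables as arguments, so that unification finds it.
  convCoeff≡partialConv P a (suc m) with _⊕_ ← _+_ | k ← suc m =
    cong (_⊕ (coeff P k * + a (m ℕ.∸ m))) (localConv≡partialConv P a k m)

  localConv≡partialConv : ∀ P a k m → _ ≡ partialConv P (λ m → + a m) k m
  localConv≡partialConv P a k zero    = refl
  localConv≡partialConv P a k (suc m) =
    cong (_+ coeff P (suc m) * + a (k ℕ.∸ suc m)) (localConv≡partialConv P a k m)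

-- Linear forms on a state vector

dot : ∀ {n} → Vec ℤ n → Vec ℤ n → ℤ
dot []      []      = + 0
dot (x ∷ u) (y ∷ v) = x * y + dot u v

axpy : ∀ {n} → ℤ → Vec ℤ n → Vec ℤ n → Vec ℤ n
axpy c = Vec.zipWith (λ x y → c * x + y)

dot-axpy : ∀ {n} c (u w v : Vec ℤ n) → dot (axpy c u w) v ≡ c * dot u v + dot w v
dot-axpy c []      []      []      = lem c
  where lem : ∀ c → + 0 ≡ c * + 0 + + 0
        lem = solve-∀
dot-axpy c (x ∷ u) (y ∷ w) (t ∷ v) = trans (cong (λ r → (c * x + y) * t + r) (dot-axpy c u w v)) (lem c x y t (dot u v) (dot w v))
  where lem : ∀ c x y t p r → (c * x + y) * t + (c * p + r) ≡ c * (x * t + p) + (y * t + r)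
        lem = solve-∀

zeros : ∀ n → Vec ℤ n
zeros n = Vec.replicate n (+ 0)

dot-zeros : ∀ {n} (v : Vec ℤ n) → dot (zeros n) v ≡ + 0
dot-zeros []      = refl
dot-zeros (x ∷ v) = trans (cong (λ r → + 0 * x + r) (dot-zeros v)) (lem x)
  where lem : ∀ x → + 0 * x + + 0 ≡ + 0
        lem = solve-∀

dot-updateAt : ∀ {n} (u v : Vec ℤ n) i c → dot (Vec.updateAt u i (λ x → x + c)) v ≡ c * Vec.lookup v i + dot u v
dot-updateAt (x ∷ u) (y ∷ v) zero    c = lem x y c (dot u v)
  where lem : ∀ x y c p → (x + c) * y + p ≡ c * y + (x * y + p)
        lem = solve-∀
dot-updateAt (x ∷ u) (y ∷ v) (suc i) c = trans (cong (λ r → x * y + r) (dot-updateAt u v i c)) (lem x y (c * Vec.lookup v i) (dot u v))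
  where lem : ∀ x y c p → x * y + (c + p) ≡ c + (x * y + p)
        lem = solve-∀

-- With sparse rows `apply` unfolds to the few nonzero terms, the shape in which the ring identities
-- of `state-suc` are stated.
SparseRow : ℕ → Set
SparseRow n = List (ℤ × Fin n)

apply : ∀ {n} → SparseRow n → Vec ℤ n → ℤ
apply []            v = + 0
apply ((c , i) ∷ r) v = c * Vec.lookup v i + apply r v

addRow : ∀ {n} → ℤ → SparseRow n → Vec ℤ n → Vec ℤ n
addRow c []            u = u
addRow c ((d , i) ∷ r) u = Vec.updateAt (addRow c r u) i (λ x → x + c * d)

dot-addRow : ∀ {n} c (r : SparseRow n) u v → dot (addRow c r u) v ≡ c * apply r v + dot u v
dot-addRow c []            u v = lem c (dot u v)
  where lem : ∀ c p → p ≡ c * + 0 + p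
        lem = solve-∀
dot-addRow c ((d , i) ∷ r) u v = begin
  dot (Vec.updateAt (addRow c r u) i (λ x → x + c * d)) v   ≡⟨ dot-updateAt (addRow c r u) v i (c * d) ⟩
  c * d * Vec.lookup v i + dot (addRow c r u) v            ≡⟨ cong (λ t → c * d * Vec.lookup v i + t) (dot-addRow c r u v) ⟩
  c * d * Vec.lookup v i + (c * apply r v + dot u v)       ≡⟨ lem c d (Vec.lookup v i) (apply r v) (dot u v) ⟩
  c * (d * Vec.lookup v i + apply r v) + dot u v           ∎
  where lem : ∀ c d x p q → c * d * x + (c * p + q) ≡ c * (d * x + p) + q
        lem = solve-∀

_⊙_ : ∀ {m n} → Vec ℤ m → Vec (SparseRow n) m → Vec ℤ n
[]      ⊙ []      = zeros _
(c ∷ u) ⊙ (r ∷ R) = addRow c r (u ⊙ R)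

dot-⊙ : ∀ {m n} (u : Vec ℤ m) (R : Vec (SparseRow n) m) v → dot (u ⊙ R) v ≡ dot u (Vec.map (λ r → apply r v) R)
dot-⊙ []      []      v = dot-zeros v
dot-⊙ (c ∷ u) (r ∷ R) v = trans (dot-addRow c r (u ⊙ R) v) (cong (λ t → c * apply r v + t) (dot-⊙ u R v))

-- The leading 1 turns the inhomogeneous recurrences into linear ones. `g n 1`, `zy n` and `q n` are
-- left out, being 1, 2 z - 1 and z - `g n 2`.
state : ℕ → Vec ℤ 15
state n = + 1 ∷ g n 2 ∷ z n ∷ α n ∷ αy n ∷ γ n ∷ δ n ∷ ε n ∷ B n ∷ By n ∷ A n ∷ Ay n ∷ C n ∷ F n ∷ K n ∷ []

transition : Vec (SparseRow 15) 15
transition =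
  ((+ 1 , # 0) ∷ []) ∷
  ((+ 1 , # 0) ∷ (+ 1 , # 1) ∷ []) ∷
  ((+ 2 , # 2) ∷ []) ∷
  ((-[1+ 0 ] , # 0) ∷ (-[1+ 0 ] , # 1) ∷ (+ 2 , # 2) ∷ (+ 1 , # 3) ∷ (+ 1 , # 4) ∷ []) ∷
  ((-[1+ 0 ] , # 0) ∷ (-[1+ 0 ] , # 1) ∷ (+ 2 , # 2) ∷ (+ 1 , # 3) ∷ (+ 2 , # 4) ∷ []) ∷
  ((-[1+ 0 ] , # 1) ∷ (+ 1 , # 2) ∷ (+ 2 , # 5) ∷ []) ∷
  ((-[1+ 0 ] , # 1) ∷ (+ 1 , # 2) ∷ (+ 1 , # 6) ∷ []) ∷
  ((-[1+ 0 ] , # 0) ∷ (+ 1 , # 1) ∷ (-[1+ 0 ] , # 2) ∷ (+ 1 , # 5) ∷ (+ 1 , # 6) ∷ (+ 2 , # 7) ∷ []) ∷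
  ((-[1+ 0 ] , # 0) ∷ (+ 2 , # 2) ∷ (+ 1 , # 9) ∷ []) ∷
  ((-[1+ 0 ] , # 0) ∷ (+ 2 , # 2) ∷ (+ 2 , # 9) ∷ []) ∷
  ((-[1+ 0 ] , # 0) ∷ (-[1+ 0 ] , # 1) ∷ (+ 2 , # 2) ∷ (+ 1 , # 3) ∷ (+ 1 , # 4) ∷ (+ 1 , # 9) ∷ (+ 1 , # 11) ∷ []) ∷
  ((-[1+ 0 ] , # 0) ∷ (-[1+ 0 ] , # 1) ∷ (+ 2 , # 2) ∷ (+ 1 , # 3) ∷ (+ 1 , # 4) ∷ (+ 1 , # 9) ∷ (+ 2 , # 11) ∷ []) ∷
  ((+ 1 , # 5) ∷ (+ 1 , # 6) ∷ (+ 1 , # 12) ∷ []) ∷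
  ((+ 1 , # 7) ∷ (+ 1 , # 12) ∷ (+ 1 , # 13) ∷ []) ∷
  ((+ 1 , # 0) ∷ (+ 1 , # 1) ∷ (-[1+ 1 ] , # 2) ∷ (-[1+ 0 ] , # 3) ∷ (-[1+ 0 ] , # 4) ∷ (+ 1 , # 12) ∷ (+ 1 , # 13) ∷ (+ 1 , # 14) ∷ []) ∷ []

state-suc : ∀ n → state (suc n) ≡ Vec.map (λ r → apply r (state n)) transition
state-suc n rewrite g-2 n =
  refl ∷≡
  n₂-suc (g n 2) ∷≡
  z-suc (z n) ∷≡
  α-suc (g n 2) (z n) (α n) (αy n) ∷≡
  αy-suc (g n 2) (z n) (α n) (αy n) ∷≡
  γ-suc (g n 2) (z n) (γ n) ∷≡
  δ-suc (g n 2) (z n) (δ n) ∷≡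
  ε-suc (g n 2) (z n) (γ n) (δ n) (ε n) ∷≡
  B-suc (z n) (By n) ∷≡
  By-suc (z n) (By n) ∷≡
  A-suc (g n 2) (z n) (α n) (αy n) (By n) (Ay n) ∷≡
  Ay-suc (g n 2) (z n) (α n) (αy n) (By n) (Ay n) ∷≡
  C-suc (γ n) (δ n) (C n) ∷≡
  F-suc (ε n) (C n) (F n) ∷≡
  K-suc (g n 2) (z n) (α n) (αy n) (C n) (F n) (K n) ∷≡ refl
  where
  _∷≡_ : ∀ {k} {x y : ℤ} {u v : Vec ℤ k} → x ≡ y → u ≡ v → x ∷ u ≡ y ∷ v
  refl ∷≡ refl = refl
  infixr 5 _∷≡_
  n₂-suc : ∀ n₂ → + 1 + n₂
    ≡ + 1 * + 1 + (+ 1 * n₂ + + 0)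
  n₂-suc = solve-∀
  z-suc : ∀ z → + 2 * z
    ≡ + 2 * z + + 0
  z-suc = solve-∀
  α-suc : ∀ n₂ z α αy → α + αy + (+ 2 * z - + 1) - n₂
    ≡ -[1+ 0 ] * + 1 + (-[1+ 0 ] * n₂ + (+ 2 * z + (+ 1 * α + (+ 1 * αy + + 0))))
  α-suc = solve-∀
  αy-suc : ∀ n₂ z α αy → (α + αy + (+ 2 * z - + 1) - n₂) + αy
    ≡ -[1+ 0 ] * + 1 + (-[1+ 0 ] * n₂ + (+ 2 * z + (+ 1 * α + (+ 2 * αy + + 0))))
  αy-suc = solve-∀
  γ-suc : ∀ n₂ z γ → + 2 * γ + (z - n₂)
    ≡ -[1+ 0 ] * n₂ + (+ 1 * z + (+ 2 * γ + + 0))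
  γ-suc = solve-∀
  δ-suc : ∀ n₂ z δ → δ + (z - n₂)
    ≡ -[1+ 0 ] * n₂ + (+ 1 * z + (+ 1 * δ + + 0))
  δ-suc = solve-∀
  ε-suc : ∀ n₂ z γ δ ε → + 2 * ε + δ + γ - (z - n₂) - + 1
    ≡ -[1+ 0 ] * + 1 + (+ 1 * n₂ + (-[1+ 0 ] * z + (+ 1 * γ + (+ 1 * δ + (+ 2 * ε + + 0)))))
  ε-suc = solve-∀
  B-suc : ∀ z By → By + (+ 2 * z - + 1)
    ≡ -[1+ 0 ] * + 1 + (+ 2 * z + (+ 1 * By + + 0))
  B-suc = solve-∀
  By-suc : ∀ z By → (By + (+ 2 * z - + 1)) + By
    ≡ -[1+ 0 ] * + 1 + (+ 2 * z + (+ 2 * By + + 0))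
  By-suc = solve-∀
  A-suc : ∀ n₂ z α αy By Ay → Ay + By + (α + αy + (+ 2 * z - + 1) - n₂)
    ≡ -[1+ 0 ] * + 1 + (-[1+ 0 ] * n₂ + (+ 2 * z + (+ 1 * α + (+ 1 * αy + (+ 1 * By + (+ 1 * Ay + + 0))))))
  A-suc = solve-∀
  Ay-suc : ∀ n₂ z α αy By Ay → (Ay + By + (α + αy + (+ 2 * z - + 1) - n₂)) + Ay
    ≡ -[1+ 0 ] * + 1 + (-[1+ 0 ] * n₂ + (+ 2 * z + (+ 1 * α + (+ 1 * αy + (+ 1 * By + (+ 2 * Ay + + 0))))))
  Ay-suc = solve-∀
  C-suc : ∀ γ δ C → C + γ + δ
    ≡ + 1 * γ + (+ 1 * δ + (+ 1 * C + + 0))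
  C-suc = solve-∀
  F-suc : ∀ ε C F → F + C + ε
    ≡ + 1 * ε + (+ 1 * C + (+ 1 * F + + 0))
  F-suc = solve-∀
  K-suc : ∀ n₂ z α αy C F K → K + C + F - (α + αy + (+ 2 * z - + 1) - n₂)
    ≡ + 1 * + 1 + (+ 1 * n₂ + (-[1+ 1 ] * z + (-[1+ 0 ] * α + (-[1+ 0 ] * αy + (+ 1 * C + (+ 1 * F + (+ 1 * K + + 0)))))))
  K-suc = solve-∀

-- The row vector of the functional A + K (positions 10 and 14 of `state`) times the k-th power of
-- the transition matrix: it reads off the value k steps ahead.
form : ℕ → Vec ℤ 15
form zero    = addRow (+ 1) ((+ 1 , # 10) ∷ (+ 1 , # 14) ∷ []) (zeros 15)
form (suc k) = form k ⊙ transition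

dot-form : ∀ k n → dot (form k) (state n) ≡ avoiders (k ℕ.+ n)
dot-form zero    n = begin
  dot (form 0) (state n)
    ≡⟨ dot-addRow (+ 1) ((+ 1 , # 10) ∷ (+ 1 , # 14) ∷ []) (zeros 15) (state n) ⟩
  + 1 * (+ 1 * A n + (+ 1 * K n + + 0)) + dot (zeros 15) (state n)
    ≡⟨ cong (λ t → + 1 * (+ 1 * A n + (+ 1 * K n + + 0)) + t) (dot-zeros (state n)) ⟩
  + 1 * (+ 1 * A n + (+ 1 * K n + + 0)) + + 0
    ≡⟨ lem (A n) (K n) ⟩
  avoiders n ∎
  where
  lem : ∀ a k → + 1 * (+ 1 * a + (+ 1 * k + + 0)) + + 0 ≡ a + k
  lem = solve-∀
dot-form (suc k) n = begin
  dot (form k ⊙ transition) (state n)                                ≡⟨ dot-⊙ (form k) transition (state n) ⟩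
  dot (form k) (Vec.map (λ r → apply r (state n)) transition)          ≡⟨ cong (dot (form k)) (sym (state-suc n)) ⟩
  dot (form k) (state (suc n))                                       ≡⟨ dot-form k (suc n) ⟩
  avoiders (k ℕ.+ suc n)                                             ≡⟨ cong avoiders (ℕ.+-suc k n) ⟩
  avoiders (suc k ℕ.+ n)                                             ∎

-- The index 12 exceeds the degree of the denominator by one: with 11 the resulting form vanishes on
-- all states but is not zero.
convForm : ℕ → Vec ℤ 15
convForm zero    = axpy (coeff denominator 0) (form 12) (zeros 15)
convForm (suc j) = axpy (coeff denominator (suc j)) (form (12 ℕ.∸ suc j)) (convForm j)

dot-convForm : ∀ n j → j ℕ.≤ 12 → dot (convForm j) (state n) ≡ partialConv denominator avoiders (12 ℕ.+ n) j
dot-convForm n zero    j≤12 = begin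
  dot (convForm 0) (state n)
    ≡⟨ dot-axpy (coeff denominator 0) (form 12) (zeros 15) (state n) ⟩
  coeff denominator 0 * dot (form 12) (state n) + dot (zeros 15) (state n)
    ≡⟨ cong₂ (λ x y → coeff denominator 0 * x + y) (dot-form 12 n) (dot-zeros (state n)) ⟩
  coeff denominator 0 * avoiders (12 ℕ.+ n) + + 0
    ≡⟨ +-identityʳ _ ⟩
  coeff denominator 0 * avoiders (12 ℕ.+ n) ∎
dot-convForm n (suc j) j<12 = begin
  dot (convForm (suc j)) (state n)
    ≡⟨ dot-axpy (coeff denominator (suc j)) (form (12 ℕ.∸ suc j)) (convForm j) (state n) ⟩
  coeff denominator (suc j) * dot (form (12 ℕ.∸ suc j)) (state n) + dot (convForm j) (state n)
    ≡⟨ cong₂ (λ x y → coeff denominator (suc j) * x + y) (dot-form (12 ℕ.∸ suc j) n) (dot-convForm n j (ℕ.<⇒≤ j<12)) ⟩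
  coeff denominator (suc j) * avoiders ((12 ℕ.∸ suc j) ℕ.+ n) + partialConv denominator avoiders (12 ℕ.+ n) j
    ≡⟨ cong (λ m → coeff denominator (suc j) * avoiders m + partialConv denominator avoiders (12 ℕ.+ n) j) (sym (ℕ.+-∸-comm n j<12)) ⟩
  coeff denominator (suc j) * avoiders (12 ℕ.+ n ℕ.∸ suc j) + partialConv denominator avoiders (12 ℕ.+ n) j
    ≡⟨ +-comm (coeff denominator (suc j) * avoiders (12 ℕ.+ n ℕ.∸ suc j)) _ ⟩
  partialConv denominator avoiders (12 ℕ.+ n) (suc j) ∎

-- The denominator has degree 6 + 3 + 2 = 11, so all later terms have coefficient zero and compute
-- to `+ 0`.
partialConv-tail : ∀ s n j → partialConv denominator s n (12 ℕ.+ j) ≡ partialConv denominator s n 11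
partialConv-tail s n zero    = +-identityʳ _
partialConv-tail s n (suc j) = trans (+-identityʳ _) (partialConv-tail s n j)

-- A relation of Cayley-Hamilton type: the reversed denominator, evaluated at the transition matrix
-- and multiplied by one more copy of it, annihilates the functional A + K. All entries are closed
-- integers, so evaluation decides it.
convForm-zeros : convForm 11 ≡ zeros 15
convForm-zeros = refl

-- The recurrence is available from index 12 on. The smaller indices, which determine the numerator,
-- are evaluated.
conv-avoiders : ∀ n → partialConv denominator avoiders n n ≡ coeff numerator n
conv-avoiders 0  = refl
conv-avoiders 1  = refl
conv-avoiders 2  = refl
conv-avoiders 3  = refl
conv-avoiders 4  = refl
conv-avoiders 5  = refl
conv-avoiders 6  = refl
conv-avoiders 7  = refl
conv-avoiders 8  = refl
conv-avoiders 9  = refl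
conv-avoiders 10 = refl
conv-avoiders 11 = refl
conv-avoiders (suc (suc (suc (suc (suc (suc (suc (suc (suc (suc (suc (suc n)))))))))))) = begin
  partialConv denominator avoiders (12 ℕ.+ n) (12 ℕ.+ n) ≡⟨ partialConv-tail avoiders (12 ℕ.+ n) n ⟩
  partialConv denominator avoiders (12 ℕ.+ n) 11        ≡⟨ sym (dot-convForm n 11 (ℕ.n≤1+n 11)) ⟩
  dot (convForm 11) (state n)                           ≡⟨ cong (λ u → dot u (state n)) convForm-zeros ⟩
  dot (zeros 15) (state n)                              ≡⟨ dot-zeros (state n) ⟩
  + 0                                                   ∎

-- Pattern occurrences

∈-subseqs⁺ : ∀ {s σ : List ℕ} → s ⊆ σ → s ∈ subseqs σ
∈-subseqs⁺ []                   = here refl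
∈-subseqs⁺ {σ = x ∷ σ} (_ ∷ʳ p) = ∈-++⁺ʳ _ (∈-subseqs⁺ p)
∈-subseqs⁺ (refl ∷ p)           = ∈-++⁺ˡ (∈-map⁺ _ (∈-subseqs⁺ p))

∈-subseqs⁻ : ∀ {s} (σ : List ℕ) → s ∈ subseqs σ → s ⊆ σ
∈-subseqs⁻ []      (here refl) = []
∈-subseqs⁻ (x ∷ σ) s∈ with ∈-++⁻ (map (x ∷_) (subseqs σ)) s∈
... | inj₂ s∈σ = x ∷ʳ ∈-subseqs⁻ σ s∈σ
... | inj₁ s∈xσ with ∈-map⁻ (x ∷_) s∈xσ
...   | s′ , s′∈σ , refl = refl ∷ ∈-subseqs⁻ σ s′∈σ

Occurs : (List ℕ → Set) → List ℕ → Set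
Occurs Q σ = ∃ λ s → s ⊆ σ × Q s

infix 3 _⇔ᵀ_
_⇔ᵀ_ : Set → Bool → Set
P ⇔ᵀ b = P ⇔ T b

T-ext : ∀ {a b} → (T a → T b) → (T b → T a) → a ≡ b
T-ext {false} {false} f g = refl
T-ext {false} {true}  f g = ⊥-elim (g tt)
T-ext {true}  {false} f g = ⊥-elim (f tt)
T-ext {true}  {true}  f g = refl

any-subseqs : ∀ {Q : List ℕ → Set} {p} → (∀ s → Q s ⇔ᵀ p s) → ∀ σ → Occurs Q σ ⇔ᵀ any p (subseqs σ)
any-subseqs {Q} {p} Q⇔p σ = mk⇔ to′ from′
  where
  to′ : Occurs Q σ → T (any p (subseqs σ))
  to′ (s , s⊆σ , Qs) = any⁺ p (lose (∈-subseqs⁺ s⊆σ) (to (Q⇔p s) Qs))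
  from′ : T (any p (subseqs σ)) → Occurs Q σ
  from′ t with find (any⁻ p (subseqs σ) t)
  ... | s , s∈ , ps = s , ∈-subseqs⁻ σ s∈ , from (Q⇔p s) ps

-- In this and the following types the letters are named by size and listed by position. Only
-- neighbours in size are compared; transitivity supplies the rest of the order isomorphism.
data Pat12 : List ℕ → Set where
  pat12 : ∀ {a b} → a < b → Pat12 (a ∷ b ∷ [])

data Pat123 : List ℕ → Set where
  pat123 : ∀ {a b c} → a < b → b < c → Pat123 (a ∷ b ∷ c ∷ [])

data Pat312 : List ℕ → Set where
  pat312 : ∀ {a b c} → a < b → b < c → Pat312 (c ∷ a ∷ b ∷ [])

data Pat1234 : List ℕ → Set where
  pat1234 : ∀ {a b c d} → a < b → b < c → c < d → Pat1234 (a ∷ b ∷ c ∷ d ∷ [])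

data Pat3412 : List ℕ → Set where
  pat3412 : ∀ {a b c d} → a < b → b < c → c < d → Pat3412 (c ∷ d ∷ a ∷ b ∷ [])

data Pat4123 : List ℕ → Set where
  pat4123 : ∀ {a b c d} → a < b → b < c → c < d → Pat4123 (d ∷ a ∷ b ∷ c ∷ [])

<ᵇ-true : ∀ {m n} → m < n → (m <ᵇ n) ≡ true
<ᵇ-true m<n = to T-≡ (ℕ.<⇒<ᵇ m<n)

<ᵇ-false : ∀ {m n} → n ≤ m → (m <ᵇ n) ≡ false
<ᵇ-false {m} {n} n≤m = ¬-not (λ eq → ℕ.≤⇒≯ n≤m (ℕ.<ᵇ⇒< m n (from T-≡ eq)))

-- For numerals u < v the hidden argument has type `⊤` and is filled in automatically.
sameOrder-up : ∀ x y u v {_ : T (u <ᵇ v)} → x < y ⇔ᵀ sameOrder x y u v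
sameOrder-up x y u v {u<v} = mk⇔ to′ from′
  where
  to′ : x < y → T (sameOrder x y u v)
  to′ x<y rewrite <ᵇ-true (ℕ.<ᵇ⇒< u v u<v) | <ᵇ-false (ℕ.<⇒≤ (ℕ.<ᵇ⇒< u v u<v)) | <ᵇ-true x<y | <ᵇ-false (ℕ.<⇒≤ x<y) = tt
  from′ : T (sameOrder x y u v) → x < y
  from′ t rewrite <ᵇ-true (ℕ.<ᵇ⇒< u v u<v) with x <ᵇ y in eq
  ... | true = ℕ.<ᵇ⇒< x y (from T-≡ eq)

sameOrder-down : ∀ x y u v {_ : T (v <ᵇ u)} → y < x ⇔ᵀ sameOrder x y u v
sameOrder-down x y u v {v<u} = mk⇔ to′ from′
  where
  to′ : y < x → T (sameOrder x y u v)
  to′ y<x rewrite <ᵇ-true (ℕ.<ᵇ⇒< v u v<u) | <ᵇ-false (ℕ.<⇒≤ (ℕ.<ᵇ⇒< v u v<u)) | <ᵇ-true y<x | <ᵇ-false (ℕ.<⇒≤ y<x) = tt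
  from′ : T (sameOrder x y u v) → y < x
  from′ t rewrite <ᵇ-true (ℕ.<ᵇ⇒< v u v<u) | <ᵇ-false (ℕ.<⇒≤ (ℕ.<ᵇ⇒< v u v<u)) with x <ᵇ y | y <ᵇ x in eq
  ... | false | true = ℕ.<ᵇ⇒< y x (from T-≡ eq)

SameOrders : ℕ → ℕ → List ℕ → List ℕ → Set
SameOrders x u (y ∷ ys) (v ∷ vs) = T (sameOrder x y u v) × SameOrders x u ys vs
-- This mirrors `zipWith`, which stops at the shorter list; unequal lengths are rejected by
-- `OrderIso`.
SameOrders x u _        _        = ⊤

OrderIso : List ℕ → List ℕ → Set
OrderIso []       []       = ⊤
OrderIso (x ∷ xs) (u ∷ us) = SameOrders x u xs us × OrderIso xs us
OrderIso _        _        = ⊥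

SameOrders⇔ : ∀ x u ys vs → SameOrders x u ys vs ⇔ᵀ all (λ b → b) (zipWith (λ y v → sameOrder x y u v) ys vs)
SameOrders⇔ x u []       vs       = mk⇔ _ _
SameOrders⇔ x u (y ∷ ys) []       = mk⇔ _ _
SameOrders⇔ x u (y ∷ ys) (v ∷ vs) = mk⇔
  (λ (p , ps) → from T-∧ (p , to (SameOrders⇔ x u ys vs) ps))
  (λ t → let p , ps = to T-∧ t in p , from (SameOrders⇔ x u ys vs) ps)

OrderIso⇔ : ∀ s τ → OrderIso s τ ⇔ᵀ orderIso s τ
OrderIso⇔ []       []       = mk⇔ _ _
OrderIso⇔ []       (u ∷ us) = mk⇔ (λ ()) (λ ())
OrderIso⇔ (x ∷ xs) []       = mk⇔ (λ ()) (λ ())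
OrderIso⇔ (x ∷ xs) (u ∷ us) = mk⇔
  (λ (p , ps) → from T-∧ (to (SameOrders⇔ x u xs us) p , to (OrderIso⇔ xs us) ps))
  (λ t → let p , ps = to T-∧ t in from (SameOrders⇔ x u xs us) p , from (OrderIso⇔ xs us) ps)

Pat12⇔OrderIso : ∀ s → Pat12 s ⇔ OrderIso s (1 ∷ 2 ∷ [])
Pat12⇔OrderIso s = mk⇔ (λ { (pat12 {a} {b} a<b) →
      (to (sameOrder-up a b 1 2) a<b , tt)
    , tt , tt })
  (from′ s)
  where
  from′ : ∀ s → OrderIso s (1 ∷ 2 ∷ []) → Pat12 s
  from′ (a ∷ b ∷ []) ((ab , _) , _ , _) =
    pat12 (from (sameOrder-up a b 1 2) ab)
  from′ (_ ∷ []) (_ , ())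
  from′ (_ ∷ _ ∷ _ ∷ _) (_ , _ , ())

Pat123⇔OrderIso : ∀ s → Pat123 s ⇔ OrderIso s (1 ∷ 2 ∷ 3 ∷ [])
Pat123⇔OrderIso s = mk⇔ (λ { (pat123 {a} {b} {c} a<b b<c) →
      (to (sameOrder-up a b 1 2) a<b , to (sameOrder-up a c 1 3) (ℕ.<-trans a<b b<c) , tt)
    , (to (sameOrder-up b c 2 3) b<c , tt)
    , tt , tt })
  (from′ s)
  where
  from′ : ∀ s → OrderIso s (1 ∷ 2 ∷ 3 ∷ []) → Pat123 s
  from′ (a ∷ b ∷ c ∷ []) ((ab , _ , _) , (bc , _) , _ , _) =
    pat123 (from (sameOrder-up a b 1 2) ab) (from (sameOrder-up b c 2 3) bc)
  from′ (_ ∷ []) (_ , ())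
  from′ (_ ∷ _ ∷ []) (_ , _ , ())
  from′ (_ ∷ _ ∷ _ ∷ _ ∷ _) (_ , _ , _ , ())

Pat312⇔OrderIso : ∀ s → Pat312 s ⇔ OrderIso s (3 ∷ 1 ∷ 2 ∷ [])
Pat312⇔OrderIso s = mk⇔ (λ { (pat312 {a} {b} {c} a<b b<c) →
      (to (sameOrder-down c a 3 1) (ℕ.<-trans a<b b<c) , to (sameOrder-down c b 3 2) b<c , tt)
    , (to (sameOrder-up a b 1 2) a<b , tt)
    , tt , tt })
  (from′ s)
  where
  from′ : ∀ s → OrderIso s (3 ∷ 1 ∷ 2 ∷ []) → Pat312 s
  from′ (c ∷ a ∷ b ∷ []) ((_ , cb , _) , (ab , _) , _ , _) =
    pat312 (from (sameOrder-up a b 1 2) ab) (from (sameOrder-down c b 3 2) cb)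
  from′ (_ ∷ []) (_ , ())
  from′ (_ ∷ _ ∷ []) (_ , _ , ())
  from′ (_ ∷ _ ∷ _ ∷ _ ∷ _) (_ , _ , _ , ())

Pat1234⇔OrderIso : ∀ s → Pat1234 s ⇔ OrderIso s (1 ∷ 2 ∷ 3 ∷ 4 ∷ [])
Pat1234⇔OrderIso s = mk⇔ (λ { (pat1234 {a} {b} {c} {d} a<b b<c c<d) →
      (to (sameOrder-up a b 1 2) a<b , to (sameOrder-up a c 1 3) (ℕ.<-trans a<b b<c) , to (sameOrder-up a d 1 4) (ℕ.<-trans (ℕ.<-trans a<b b<c) c<d) , tt)
    , (to (sameOrder-up b c 2 3) b<c , to (sameOrder-up b d 2 4) (ℕ.<-trans b<c c<d) , tt)
    , (to (sameOrder-up c d 3 4) c<d , tt)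
    , tt , tt })
  (from′ s)
  where
  from′ : ∀ s → OrderIso s (1 ∷ 2 ∷ 3 ∷ 4 ∷ []) → Pat1234 s
  from′ (a ∷ b ∷ c ∷ d ∷ []) ((ab , _ , _ , _) , (bc , _ , _) , (cd , _) , _ , _) =
    pat1234 (from (sameOrder-up a b 1 2) ab) (from (sameOrder-up b c 2 3) bc) (from (sameOrder-up c d 3 4) cd)
  from′ (_ ∷ []) (_ , ())
  from′ (_ ∷ _ ∷ []) (_ , _ , ())
  from′ (_ ∷ _ ∷ _ ∷ []) (_ , _ , _ , ())
  from′ (_ ∷ _ ∷ _ ∷ _ ∷ _ ∷ _) (_ , _ , _ , _ , ())

Pat3412⇔OrderIso : ∀ s → Pat3412 s ⇔ OrderIso s (3 ∷ 4 ∷ 1 ∷ 2 ∷ [])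
Pat3412⇔OrderIso s = mk⇔ (λ { (pat3412 {a} {b} {c} {d} a<b b<c c<d) →
      (to (sameOrder-up c d 3 4) c<d , to (sameOrder-down c a 3 1) (ℕ.<-trans a<b b<c) , to (sameOrder-down c b 3 2) b<c , tt)
    , (to (sameOrder-down d a 4 1) (ℕ.<-trans (ℕ.<-trans a<b b<c) c<d) , to (sameOrder-down d b 4 2) (ℕ.<-trans b<c c<d) , tt)
    , (to (sameOrder-up a b 1 2) a<b , tt)
    , tt , tt })
  (from′ s)
  where
  from′ : ∀ s → OrderIso s (3 ∷ 4 ∷ 1 ∷ 2 ∷ []) → Pat3412 s
  from′ (c ∷ d ∷ a ∷ b ∷ []) ((cd , _ , cb , _) , (_ , _ , _) , (ab , _) , _ , _) =
    pat3412 (from (sameOrder-up a b 1 2) ab) (from (sameOrder-down c b 3 2) cb) (from (sameOrder-up c d 3 4) cd)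
  from′ (_ ∷ []) (_ , ())
  from′ (_ ∷ _ ∷ []) (_ , _ , ())
  from′ (_ ∷ _ ∷ _ ∷ []) (_ , _ , _ , ())
  from′ (_ ∷ _ ∷ _ ∷ _ ∷ _ ∷ _) (_ , _ , _ , _ , ())

Pat4123⇔OrderIso : ∀ s → Pat4123 s ⇔ OrderIso s (4 ∷ 1 ∷ 2 ∷ 3 ∷ [])
Pat4123⇔OrderIso s = mk⇔ (λ { (pat4123 {a} {b} {c} {d} a<b b<c c<d) →
      (to (sameOrder-down d a 4 1) (ℕ.<-trans (ℕ.<-trans a<b b<c) c<d) , to (sameOrder-down d b 4 2) (ℕ.<-trans b<c c<d) , to (sameOrder-down d c 4 3) c<d , tt)
    , (to (sameOrder-up a b 1 2) a<b , to (sameOrder-up a c 1 3) (ℕ.<-trans a<b b<c) , tt)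
    , (to (sameOrder-up b c 2 3) b<c , tt)
    , tt , tt })
  (from′ s)
  where
  from′ : ∀ s → OrderIso s (4 ∷ 1 ∷ 2 ∷ 3 ∷ []) → Pat4123 s
  from′ (d ∷ a ∷ b ∷ c ∷ []) ((_ , _ , dc , _) , (ab , _ , _) , (bc , _) , _ , _) =
    pat4123 (from (sameOrder-up a b 1 2) ab) (from (sameOrder-up b c 2 3) bc) (from (sameOrder-down d c 4 3) dc)
  from′ (_ ∷ []) (_ , ())
  from′ (_ ∷ _ ∷ []) (_ , _ , ())
  from′ (_ ∷ _ ∷ _ ∷ []) (_ , _ , _ , ())
  from′ (_ ∷ _ ∷ _ ∷ _ ∷ _ ∷ _) (_ , _ , _ , _ , ())

Pat12⇔ : ∀ s → Pat12 s ⇔ᵀ orderIso s (1 ∷ 2 ∷ [])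
Pat12⇔ s = OrderIso⇔ s _ ⇔-∘ Pat12⇔OrderIso s

Pat123⇔ : ∀ s → Pat123 s ⇔ᵀ orderIso s (1 ∷ 2 ∷ 3 ∷ [])
Pat123⇔ s = OrderIso⇔ s _ ⇔-∘ Pat123⇔OrderIso s

Pat312⇔ : ∀ s → Pat312 s ⇔ᵀ orderIso s (3 ∷ 1 ∷ 2 ∷ [])
Pat312⇔ s = OrderIso⇔ s _ ⇔-∘ Pat312⇔OrderIso s

Pat1234⇔ : ∀ s → Pat1234 s ⇔ᵀ orderIso s (1 ∷ 2 ∷ 3 ∷ 4 ∷ [])
Pat1234⇔ s = OrderIso⇔ s _ ⇔-∘ Pat1234⇔OrderIso s

Pat3412⇔ : ∀ s → Pat3412 s ⇔ᵀ orderIso s (3 ∷ 4 ∷ 1 ∷ 2 ∷ [])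
Pat3412⇔ s = OrderIso⇔ s _ ⇔-∘ Pat3412⇔OrderIso s

Pat4123⇔ : ∀ s → Pat4123 s ⇔ᵀ orderIso s (4 ∷ 1 ∷ 2 ∷ 3 ∷ [])
Pat4123⇔ s = OrderIso⇔ s _ ⇔-∘ Pat4123⇔OrderIso s

-- Insertion of a maximum

⊆-insert⁻ : ∀ {s : List ℕ} α {M β} → s ⊆ α ++ M ∷ β →
  s ⊆ α ++ β ⊎ (∃ λ s₁ → ∃ λ s₂ → s ≡ s₁ ++ M ∷ s₂ × s₁ ⊆ α × s₂ ⊆ β)
⊆-insert⁻ []      (_ ∷ʳ p)   = inj₁ p
⊆-insert⁻ []      (refl ∷ p) = inj₂ ([] , _ , refl , [] , p)
⊆-insert⁻ (x ∷ α) (_ ∷ʳ p) with ⊆-insert⁻ α p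
... | inj₁ q                           = inj₁ (x ∷ʳ q)
... | inj₂ (s₁ , s₂ , eq , s₁⊆ , s₂⊆) = inj₂ (s₁ , s₂ , eq , x ∷ʳ s₁⊆ , s₂⊆)
⊆-insert⁻ (x ∷ α) (refl ∷ p) with ⊆-insert⁻ α p
... | inj₁ q                           = inj₁ (refl ∷ q)
... | inj₂ (s₁ , s₂ , eq , s₁⊆ , s₂⊆) = inj₂ (x ∷ s₁ , s₂ , cong (x ∷_) eq , refl ∷ s₁⊆ , s₂⊆)

⊆-insert⁺ : ∀ (α : List ℕ) M β → α ++ β ⊆ α ++ M ∷ β
⊆-insert⁺ α M β = ++⁺ (⊆-refl {x = α}) (M ∷ʳ ⊆-refl)

Below : ℕ → List ℕ → Set
Below M = All (_< M)

has12 has123 : List ℕ → Bool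
has12  σ = contains σ (1 ∷ 2 ∷ [])
has123 σ = contains σ (1 ∷ 2 ∷ 3 ∷ [])

has12⇔ : ∀ σ → Occurs Pat12 σ ⇔ᵀ has12 σ
has12⇔ = any-subseqs Pat12⇔

has123⇔ : ∀ σ → Occurs Pat123 σ ⇔ᵀ has123 σ
has123⇔ = any-subseqs Pat123⇔

-- A 312 with its 3 in α and its 12 in β, which a maximum placed between them turns into 3412.
cross : List ℕ → List ℕ → Bool
cross α β = any (λ c → any (λ s → orderIso (c ∷ s) (3 ∷ 1 ∷ 2 ∷ [])) (subseqs β)) α

Crosses : List ℕ → List ℕ → Set
Crosses α β = ∃ λ c → c ∈ α × Occurs (Pat312 ∘ (c ∷_)) β

cross⇔ : ∀ α β → Crosses α β ⇔ᵀ cross α β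
cross⇔ α β = mk⇔
  (λ (c , c∈ , occ) → any⁺ _ (lose c∈ (to (inner c) occ)))
  (λ t → let c , c∈ , t′ = find (any⁻ _ α t) in c , c∈ , from (inner c) t′)
  where
  inner : ∀ c → Occurs (Pat312 ∘ (c ∷_)) β ⇔ᵀ any (λ s → orderIso (c ∷ s) (3 ∷ 1 ∷ 2 ∷ [])) (subseqs β)
  inner c = any-subseqs (λ s → Pat312⇔ (c ∷ s)) β

-- An occurrence that misses M lies in α ++ β. The Boolean b has to detect only the occurrences that
-- use M.
contains-insert : ∀ {Q τ} → (∀ s → Q s ⇔ᵀ orderIso s τ) → ∀ α M β b
  → (∀ s₁ s₂ → s₁ ⊆ α → s₂ ⊆ β → Q (s₁ ++ M ∷ s₂) → T b) → (T b → Occurs Q (α ++ M ∷ β))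
  → contains (α ++ M ∷ β) τ ≡ contains (α ++ β) τ ∨ b
contains-insert {Q} {τ} Q⇔ α M β b sound complete = T-ext to′ from′
  where
  to′ : T (contains (α ++ M ∷ β) τ) → T (contains (α ++ β) τ ∨ b)
  to′ t with from (any-subseqs Q⇔ (α ++ M ∷ β)) t
  ... | s , s⊆ , Qs with ⊆-insert⁻ α s⊆
  ...   | inj₁ s⊆′                           = from T-∨ (inj₁ (to (any-subseqs Q⇔ (α ++ β)) (s , s⊆′ , Qs)))
  ...   | inj₂ (s₁ , s₂ , refl , s₁⊆ , s₂⊆) = from T-∨ (inj₂ (sound s₁ s₂ s₁⊆ s₂⊆ Qs))
  from′ : T (contains (α ++ β) τ ∨ b) → T (contains (α ++ M ∷ β) τ)
  from′ t with to T-∨ t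
  ... | inj₂ tb = to (any-subseqs Q⇔ (α ++ M ∷ β)) (complete tb)
  ... | inj₁ tc with from (any-subseqs Q⇔ (α ++ β)) tc
  ...   | s , s⊆ , Qs = to (any-subseqs Q⇔ (α ++ M ∷ β)) (s , ⊆-trans s⊆ (⊆-insert⁺ α M β) , Qs)

module _ {M} α β (α<M : Below M α) (β<M : Below M β) where

  private
    before<M : ∀ {s} → s ⊆ α → Below M s
    before<M s⊆α = All-resp-⊆ s⊆α α<M

    after<M : ∀ {s} → s ⊆ β → Below M s
    after<M s⊆β = All-resp-⊆ s⊆β β<M

  -- A strict maximum can only play the largest letter, so the rest of the pattern splits into a
  -- part in α and a part in β. In `sound`, here and below, the length of s₁ tells which letter M
  -- plays, and the wrong roles contradict maximality.
  has123-insert : has123 (α ++ M ∷ β) ≡ has123 (α ++ β) ∨ has12 α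
  has123-insert = contains-insert Pat123⇔ α M β (has12 α) sound complete
    where
    sound : ∀ s₁ s₂ → s₁ ⊆ α → s₂ ⊆ β → Pat123 (s₁ ++ M ∷ s₂) → T (has12 α)
    sound []                 s₂ p q (pat123 M<b _) with after<M q
    ... | b<M ∷ _ = ⊥-elim (ℕ.<-asym M<b b<M)
    sound (a ∷ [])           s₂ p q (pat123 _ M<c) with after<M q
    ... | c<M ∷ _ = ⊥-elim (ℕ.<-asym M<c c<M)
    sound (a ∷ b ∷ [])       [] p q (pat123 a<b _) = to (has12⇔ α) (_ , p , pat12 a<b)
    sound (_ ∷ _ ∷ _ ∷ [])      s₂ p q ()
    sound (_ ∷ _ ∷ _ ∷ _ ∷ _) s₂ p q ()
    complete : T (has12 α) → Occurs Pat123 (α ++ M ∷ β)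
    complete t with from (has12⇔ α) t
    ... | _ , p , pat12 a<b with before<M p
    ...   | _ ∷ b<M ∷ [] = _ , ++⁺ p (refl ∷ minimum β) , pat123 a<b b<M

  has1234-insert : contains (α ++ M ∷ β) (1 ∷ 2 ∷ 3 ∷ 4 ∷ []) ≡ contains (α ++ β) (1 ∷ 2 ∷ 3 ∷ 4 ∷ []) ∨ has123 α
  has1234-insert = contains-insert Pat1234⇔ α M β (has123 α) sound complete
    where
    sound : ∀ s₁ s₂ → s₁ ⊆ α → s₂ ⊆ β → Pat1234 (s₁ ++ M ∷ s₂) → T (has123 α)
    sound []                     s₂ p q (pat1234 M<b _ _) with after<M q
    ... | b<M ∷ _ = ⊥-elim (ℕ.<-asym M<b b<M)
    sound (_ ∷ [])               s₂ p q (pat1234 _ M<c _) with after<M q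
    ... | c<M ∷ _ = ⊥-elim (ℕ.<-asym M<c c<M)
    sound (_ ∷ _ ∷ [])           s₂ p q (pat1234 _ _ M<d) with after<M q
    ... | d<M ∷ _ = ⊥-elim (ℕ.<-asym M<d d<M)
    sound (_ ∷ _ ∷ _ ∷ [])       [] p q (pat1234 a<b b<c _) = to (has123⇔ α) (_ , p , pat123 a<b b<c)
    sound (_ ∷ _ ∷ _ ∷ _ ∷ [])      s₂ p q ()
    sound (_ ∷ _ ∷ _ ∷ _ ∷ _ ∷ _) s₂ p q ()
    complete : T (has123 α) → Occurs Pat1234 (α ++ M ∷ β)
    complete t with from (has123⇔ α) t
    ... | _ , p , pat123 a<b b<c with before<M p
    ...   | _ ∷ _ ∷ c<M ∷ [] = _ , ++⁺ p (refl ∷ minimum β) , pat1234 a<b b<c c<M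

  has4123-insert : contains (α ++ M ∷ β) (4 ∷ 1 ∷ 2 ∷ 3 ∷ []) ≡ contains (α ++ β) (4 ∷ 1 ∷ 2 ∷ 3 ∷ []) ∨ has123 β
  has4123-insert = contains-insert Pat4123⇔ α M β (has123 β) sound complete
    where
    sound : ∀ s₁ s₂ → s₁ ⊆ α → s₂ ⊆ β → Pat4123 (s₁ ++ M ∷ s₂) → T (has123 β)
    sound []                     s₂ p q (pat4123 a<b b<c _) = to (has123⇔ β) (_ , q , pat123 a<b b<c)
    sound (_ ∷ [])               s₂ p q (pat4123 M<b _ _) with after<M q
    ... | b<M ∷ _ = ⊥-elim (ℕ.<-asym M<b b<M)
    sound (_ ∷ _ ∷ [])           s₂ p q (pat4123 _ M<c _) with after<M q
    ... | c<M ∷ _ = ⊥-elim (ℕ.<-asym M<c c<M)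
    sound (_ ∷ _ ∷ _ ∷ [])       s₂ p q (pat4123 _ _ M<d) with before<M p
    ... | d<M ∷ _ = ⊥-elim (ℕ.<-asym M<d d<M)
    sound (_ ∷ _ ∷ _ ∷ _ ∷ [])      s₂ p q ()
    sound (_ ∷ _ ∷ _ ∷ _ ∷ _ ∷ _) s₂ p q ()
    complete : T (has123 β) → Occurs Pat4123 (α ++ M ∷ β)
    complete t with from (has123⇔ β) t
    ... | _ , q , pat123 a<b b<c with after<M q
    ...   | _ ∷ _ ∷ c<M ∷ [] = _ , ++⁺ˡ α (refl ∷ q) , pat4123 a<b b<c c<M

  has3412-insert : contains (α ++ M ∷ β) (3 ∷ 4 ∷ 1 ∷ 2 ∷ []) ≡ contains (α ++ β) (3 ∷ 4 ∷ 1 ∷ 2 ∷ []) ∨ cross α β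
  has3412-insert = contains-insert Pat3412⇔ α M β (cross α β) sound complete
    where
    sound : ∀ s₁ s₂ → s₁ ⊆ α → s₂ ⊆ β → Pat3412 (s₁ ++ M ∷ s₂) → T (cross α β)
    sound []                     s₂ p q (pat3412 _ _ M<d) with after<M q
    ... | d<M ∷ _ = ⊥-elim (ℕ.<-asym M<d d<M)
    sound (c ∷ [])               s₂ p q (pat3412 a<b b<c _) =
      to (cross⇔ α β) (c , to∈ p , _ , q , pat312 a<b b<c)
    sound (_ ∷ _ ∷ [])           s₂ p q (pat3412 M<b _ _) with after<M q
    ... | b<M ∷ _ = ⊥-elim (ℕ.<-asym M<b b<M)
    sound (_ ∷ _ ∷ _ ∷ [])       s₂ p q (pat3412 _ M<c _) with before<M p
    ... | c<M ∷ _ = ⊥-elim (ℕ.<-asym M<c c<M)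
    sound (_ ∷ _ ∷ _ ∷ _ ∷ [])      s₂ p q ()
    sound (_ ∷ _ ∷ _ ∷ _ ∷ _ ∷ _) s₂ p q ()
    complete : T (cross α β) → Occurs Pat3412 (α ++ M ∷ β)
    complete t with from (cross⇔ α β) t
    ... | c , c∈α , _ , q , pat312 a<b b<c = _ , ++⁺ (from∈ c∈α) (refl ∷ q) , pat3412 a<b b<c (All.lookup α<M c∈α)

-- M exceeds every entry of α that could serve as the 3, so it cannot belong to the 12.
cross-insertʳ : ∀ {M} α β₁ β₂ → Below M α → Below M β₂ → cross α (β₁ ++ M ∷ β₂) ≡ cross α (β₁ ++ β₂)
cross-insertʳ {M} α β₁ β₂ α<M β₂<M = T-ext to′ from′
  where
  to′ : T (cross α (β₁ ++ M ∷ β₂)) → T (cross α (β₁ ++ β₂))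
  to′ t with from (cross⇔ α (β₁ ++ M ∷ β₂)) t
  ... | c , c∈ , s , s⊆ , pat with ⊆-insert⁻ β₁ s⊆
  ...   | inj₁ s⊆′ = to (cross⇔ α (β₁ ++ β₂)) (c , c∈ , s , s⊆′ , pat)
  to′ t | c , c∈ , _ , s⊆ , pat312 M<b _ | inj₂ ([] , _ , refl , _ , s₂⊆) with All-resp-⊆ s₂⊆ β₂<M
  ... | b<M ∷ [] = ⊥-elim (ℕ.<-asym M<b b<M)
  to′ t | c , c∈ , _ , s⊆ , pat312 _ M<c | inj₂ (_ ∷ [] , _ , refl , _ , s₂⊆) = ⊥-elim (ℕ.<-asym M<c (All.lookup α<M c∈))
  to′ t | c , c∈ , _ , s⊆ , () | inj₂ (_ ∷ _ ∷ [] , _ , refl , _ , s₂⊆)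
  to′ t | c , c∈ , _ , s⊆ , () | inj₂ (_ ∷ _ ∷ _ ∷ _ , _ , refl , _ , s₂⊆)
  from′ : T (cross α (β₁ ++ β₂)) → T (cross α (β₁ ++ M ∷ β₂))
  from′ t with from (cross⇔ α (β₁ ++ β₂)) t
  ... | c , c∈ , s , s⊆ , pat = to (cross⇔ α (β₁ ++ M ∷ β₂)) (c , c∈ , s , ⊆-trans s⊆ (⊆-insert⁺ β₁ M β₂) , pat)

-- M exceeds all of β, so it serves as the 3 for every 12 in β.
cross-insertˡ : ∀ {M} α₁ α₂ β → Below M β → cross (α₁ ++ M ∷ α₂) β ≡ cross (α₁ ++ α₂) β ∨ has12 β
cross-insertˡ {M} α₁ α₂ β β<M = T-ext to′ from′
  where
  to′ : T (cross (α₁ ++ M ∷ α₂) β) → T (cross (α₁ ++ α₂) β ∨ has12 β)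
  to′ t with from (cross⇔ (α₁ ++ M ∷ α₂) β) t
  ... | c , c∈ , occ with ∈-++⁻ α₁ c∈
  ...   | inj₁ c∈α₁         = from T-∨ (inj₁ (to (cross⇔ (α₁ ++ α₂) β) (c , ∈-++⁺ˡ c∈α₁ , occ)))
  ...   | inj₂ (there c∈α₂) = from T-∨ (inj₁ (to (cross⇔ (α₁ ++ α₂) β) (c , ∈-++⁺ʳ α₁ c∈α₂ , occ)))
  to′ t | c , c∈ , _ , s⊆ , pat312 a<b _ | inj₂ (here _) =
    from (T-∨ {cross (α₁ ++ α₂) β}) (inj₂ (to (has12⇔ β) (_ , s⊆ , pat12 a<b)))
  from′ : T (cross (α₁ ++ α₂) β ∨ has12 β) → T (cross (α₁ ++ M ∷ α₂) β)
  from′ t with to (T-∨ {cross (α₁ ++ α₂) β}) t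
  ... | inj₁ tc with from (cross⇔ (α₁ ++ α₂) β) tc
  ...   | c , c∈ , occ = to (cross⇔ (α₁ ++ M ∷ α₂) β) (c , Any-resp-⊆ (⊆-insert⁺ α₁ M α₂) c∈ , occ)
  from′ t | inj₂ th with from (has12⇔ β) th
  ... | _ , s⊆ , pat12 a<b with All-resp-⊆ s⊆ β<M
  ...   | _ ∷ b<M ∷ [] = to (cross⇔ (α₁ ++ M ∷ α₂) β) (M , ∈-++⁺ʳ α₁ (here refl) , _ , s⊆ , pat312 a<b b<M)

decreasing : List ℕ → Bool
decreasing (x ∷ y ∷ σ) = not (x <ᵇ y) ∧ decreasing (y ∷ σ)
decreasing _           = true

-- If neighbours never increase, then by transitivity no pair does. This is why ascents, a local
-- datum, suffice in the words.
decreasing≡ : ∀ σ → decreasing σ ≡ not (has12 σ)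
decreasing≡ σ = T-ext
  (λ t → to T-not (λ h → noAscent σ t (from (has12⇔ σ) h)))
  (λ t → decr σ (λ occ → from T-not t (to (has12⇔ σ) occ)))
  where
  T-not : ∀ {b} → (¬ T b) ⇔ᵀ not b
  T-not {true}  = mk⇔ (λ f → f tt) (λ ())
  T-not {false} = mk⇔ _ (λ _ ())
  linked : ∀ σ → T (decreasing σ) → Linked ℕ._≥_ σ
  linked []          t = []
  linked (x ∷ [])    t = [-]
  linked (x ∷ y ∷ σ) t = let x≮y , t′ = to T-∧ t in
    ℕ.≮⇒≥ (λ x<y → from T-not x≮y (ℕ.<⇒<ᵇ x<y)) ∷ linked (y ∷ σ) t′
  noPair : ∀ {σ a b} → AllPairs ℕ._≥_ σ → a ∷ b ∷ [] ⊆ σ → b ≤ a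
  noPair (_ ∷ desc) (_ ∷ʳ p)   = noPair desc p
  noPair (a≥ ∷ _)   (refl ∷ p) = All.lookup a≥ (to∈ p)
  noAscent : ∀ σ → T (decreasing σ) → ¬ Occurs Pat12 σ
  noAscent σ t (_ , s⊆σ , pat12 a<b) =
    ℕ.<⇒≱ a<b (noPair (Linked⇒AllPairs (λ p q → ℕ.≤-trans q p) (linked σ t)) s⊆σ)
  decr : ∀ σ → ¬ Occurs Pat12 σ → T (decreasing σ)
  decr []          ¬occ = tt
  decr (x ∷ [])    ¬occ = tt
  decr (x ∷ y ∷ σ) ¬occ = from T-∧
    (to T-not (λ t → ¬occ (_ , refl ∷ refl ∷ minimum σ , pat12 (ℕ.<ᵇ⇒< x y t)))
    , decr (y ∷ σ) (λ (s , s⊆ , p) → ¬occ (s , x ∷ʳ s⊆ , p)))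

-- The factors follow the order of `patternsT`: a maximum placed between α and β creates no 1234, no
-- 3412, no 4123.
active : List ℕ → List ℕ → Bool
active α β = not (has123 α) ∧ not (cross α β) ∧ not (has123 β)

avoids : List ℕ → Bool
avoids = avoidsAll patternsT

module _ {M} α β (α<M : Below M α) (β<M : Below M β) where

  avoids-insert : avoids (α ++ M ∷ β) ≡ avoids (α ++ β) ∧ active α β
  avoids-insert rewrite has1234-insert α β α<M β<M | has3412-insert α β α<M β<M | has4123-insert α β α<M β<M =
    lem (contains (α ++ β) _) (contains (α ++ β) _) (contains (α ++ β) _) (has123 α) (cross α β) (has123 β)
    where
    lem : ∀ a b c x y z → not (a ∨ x) ∧ not (b ∨ y) ∧ not (c ∨ z) ∧ true ≡ (not a ∧ not b ∧ not c ∧ true) ∧ not x ∧ not y ∧ not z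
    lem true  b     c     x     y     z = refl
    lem false true  c     true  y     z = refl
    lem false true  c     false y     z = refl
    lem false false true  true  y     z = refl
    lem false false true  false true  z = refl
    lem false false true  false false z = refl
    lem false false false true  y     z = refl
    lem false false false false true  z = refl
    lem false false false false false z = ∧-identityʳ (not z)

active-insertʳ : ∀ {M} α β₁ β₂ → Below M α → Below M β₁ → Below M β₂ →
  active α (β₁ ++ M ∷ β₂) ≡ active α (β₁ ++ β₂) ∧ decreasing β₁
active-insertʳ α β₁ β₂ α<M β₁<M β₂<M
  rewrite cross-insertʳ α β₁ β₂ α<M β₂<M | has123-insert β₁ β₂ β₁<M β₂<M | decreasing≡ β₁ =
  lem (has123 α) (cross α (β₁ ++ β₂)) (has123 (β₁ ++ β₂)) (has12 β₁)
  where
  lem : ∀ a b c d → not a ∧ not b ∧ not (c ∨ d) ≡ (not a ∧ not b ∧ not c) ∧ not d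
  lem true  b     c     d = refl
  lem false true  c     d = refl
  lem false false true  d = refl
  lem false false false d = refl

active-insertˡ : ∀ {M} α₁ α₂ β → Below M α₁ → Below M α₂ → Below M β →
  active (α₁ ++ M ∷ α₂) β ≡ active (α₁ ++ α₂) β ∧ decreasing α₁ ∧ decreasing β
active-insertˡ α₁ α₂ β α₁<M α₂<M β<M
  rewrite cross-insertˡ α₁ α₂ β β<M | has123-insert α₁ α₂ α₁<M α₂<M | decreasing≡ α₁ | decreasing≡ β =
  lem (has123 (α₁ ++ α₂)) (cross (α₁ ++ α₂) β) (has123 β) (has12 α₁) (has12 β)
  where
  lem : ∀ a b c d e → not (a ∨ d) ∧ not (b ∨ e) ∧ not c ≡ (not a ∧ not b ∧ not c) ∧ not d ∧ not e
  lem true  b     c     d     e = refl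
  lem false true  c     true  e = refl
  lem false true  c     false e = refl
  lem false false true  true  e = refl
  lem false false true  false true = refl
  lem false false true  false false = refl
  lem false false false true  e = refl
  lem false false false false e = ∧-identityʳ (not e)

-- The word of a permutation

asc : ℕ → List ℕ → Bool
asc p []      = false
asc p (y ∷ β) = p <ᵇ y

-- after α β is the word of the sites of α ++ β that lie to the right of the site (α, β). Including
-- that site gives cells α p β, where p is the last entry of α.
mutual
  cells : List ℕ → ℕ → List ℕ → List Cell
  cells α p β = cell (active α β) (asc p β) (after α β)

  after : List ℕ → List ℕ → List Cell
  after α []      = []
  after α (y ∷ β) = cells (α ++ [ y ]) y β

-- The sites of α ++ δ ++ β from (α, δ ++ β) up to, but not including, (α ++ δ, β).
inits : List ℕ → ℕ → List ℕ → List ℕ → List Cell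
inits α p []      β = []
inits α p (y ∷ δ) β = cell (active α (y ∷ δ ++ β)) (p <ᵇ y) (inits (α ++ [ y ]) y δ β)

lastOr : ℕ → List ℕ → ℕ
lastOr p []      = p
lastOr p (y ∷ δ) = lastOr y δ

lastOr-snoc : ∀ p δ y → lastOr p (δ ++ [ y ]) ≡ y
lastOr-snoc p []      y = refl
lastOr-snoc p (z ∷ δ) y = lastOr-snoc z δ y

snoc-++ : ∀ (α : List ℕ) y δ → (α ++ [ y ]) ++ δ ≡ α ++ y ∷ δ
snoc-++ α y δ = ++-assoc α [ y ] δ

cells-++ : ∀ α p δ β → cells α p (δ ++ β) ≡ inits α p δ β ++ cells (α ++ δ) (lastOr p δ) β
cells-++ α p []      β = cong (λ α′ → cells α′ p β) (sym (++-identityʳ α))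
cells-++ α p (y ∷ δ) β = begin
  cell a s (cells (α ++ [ y ]) y (δ ++ β))
    ≡⟨ cong (cell a s) (cells-++ (α ++ [ y ]) y δ β) ⟩
  cell a s (inits (α ++ [ y ]) y δ β ++ cells ((α ++ [ y ]) ++ δ) (lastOr y δ) β)
    ≡⟨ cell-++ a s _ _ ⟩
  inits α p (y ∷ δ) β ++ cells ((α ++ [ y ]) ++ δ) (lastOr y δ) β
    ≡⟨ cong (λ α′ → inits α p (y ∷ δ) β ++ cells α′ (lastOr y δ) β) (snoc-++ α y δ) ⟩
  inits α p (y ∷ δ) β ++ cells (α ++ y ∷ δ) (lastOr y δ) β ∎
  where
  a = active α (y ∷ δ ++ β)
  s = p <ᵇ y

inits-snoc : ∀ α p δ y β →
  inits α p (δ ++ [ y ]) β ≡ inits α p δ (y ∷ β) ++ cell (active (α ++ δ) (y ∷ β)) (lastOr p δ <ᵇ y) []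
inits-snoc α p []      y β = cong (λ α′ → cell (active α′ (y ∷ β)) (p <ᵇ y) []) (sym (++-identityʳ α))
inits-snoc α p (z ∷ δ) y β = begin
  cell (active α (z ∷ (δ ++ [ y ]) ++ β)) (p <ᵇ z) (inits (α ++ [ z ]) z (δ ++ [ y ]) β)
    ≡⟨ cong₂ (λ β′ w → cell (active α (z ∷ β′)) (p <ᵇ z) w) (snoc-++ δ y β) (inits-snoc (α ++ [ z ]) z δ y β) ⟩
  cell (active α (z ∷ δ ++ y ∷ β)) (p <ᵇ z) (inits (α ++ [ z ]) z δ (y ∷ β) ++ cell (active ((α ++ [ z ]) ++ δ) (y ∷ β)) (lastOr z δ <ᵇ y) [])
    ≡⟨ cell-++ (active α (z ∷ δ ++ y ∷ β)) (p <ᵇ z) _ _ ⟩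
  inits α p (z ∷ δ) (y ∷ β) ++ cell (active ((α ++ [ z ]) ++ δ) (y ∷ β)) (lastOr z δ <ᵇ y) []
    ≡⟨ cong (λ α′ → inits α p (z ∷ δ) (y ∷ β) ++ cell (active α′ (y ∷ β)) (lastOr z δ <ᵇ y) []) (snoc-++ α z δ) ⟩
  inits α p (z ∷ δ) (y ∷ β) ++ cell (active (α ++ z ∷ δ) (y ∷ β)) (lastOr z δ <ᵇ y) [] ∎

noAsc-cell : ∀ a s w → noAsc (cell a s w) ≡ not s ∧ noAsc w
noAsc-cell false false w = refl
noAsc-cell false true  w = refl
noAsc-cell true  s     w = refl

kill-cell : ∀ p a s w → kill p (cell a s w) ≡ cell (a ∧ (p ∧ noAsc w)) s (kill p w)
kill-cell p false false w = refl
kill-cell p false true  w = refl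
kill-cell p true  s     w = refl

-- `cell` omits only sites that no ascent straddles, so the word still records every ascent. The p
-- is there because the first site lies between p and the head of β.
noAsc-cells : ∀ α p β → noAsc (cells α p β) ≡ decreasing (p ∷ β)
noAsc-cells α p []      = noAsc-cell (active α []) false []
noAsc-cells α p (y ∷ β) = trans (noAsc-cell (active α (y ∷ β)) (p <ᵇ y) _) (cong (not (p <ᵇ y) ∧_) (noAsc-cells (α ++ [ y ]) y β))

noAsc-after : ∀ α β → noAsc (after α β) ≡ decreasing β
noAsc-after α []      = refl
noAsc-after α (y ∷ β) = noAsc-cells (α ++ [ y ]) y β

noAsc-inits : ∀ α p δ β → noAsc (inits α p δ β) ≡ decreasing (p ∷ δ)
noAsc-inits α p []      β = refl
noAsc-inits α p (y ∷ δ) β = trans (noAsc-cell (active α (y ∷ δ ++ β)) (p <ᵇ y) _) (cong (not (p <ᵇ y) ∧_) (noAsc-inits (α ++ [ y ]) y δ β))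

-- The entries between a site and M are exactly those whose ascents the remaining cells record, so
-- the test in `kill` is that of `active-insertʳ`. The ascent that ends in M is not among these
-- cells.
inits-insert : ∀ {M} α p δ β → Below M α → Below M δ → Below M β →
  inits α p δ (M ∷ β) ≡ kill true (inits α p δ β)
inits-insert α p []      β α<M _           β<M = refl
inits-insert {M} α p (y ∷ δ) β α<M δ<M@(y<M ∷ δ′<M) β<M = begin
  cell (active α (y ∷ δ ++ M ∷ β)) s (inits (α ++ [ y ]) y δ (M ∷ β))
    ≡⟨ cong₂ (λ a → cell a s) (active-insertʳ α (y ∷ δ) β α<M δ<M β<M)
        (inits-insert (α ++ [ y ]) y δ β (All.++⁺ α<M (y<M ∷ [])) δ′<M β<M) ⟩
  cell (active α (y ∷ δ ++ β) ∧ decreasing (y ∷ δ)) s (kill true w)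
    ≡⟨ cong (λ d → cell (active α (y ∷ δ ++ β) ∧ d) s (kill true w)) (sym (noAsc-inits (α ++ [ y ]) y δ β)) ⟩
  cell (active α (y ∷ δ ++ β) ∧ noAsc w) s (kill true w)
    ≡⟨ sym (kill-cell true (active α (y ∷ δ ++ β)) s w) ⟩
  kill true (inits α p (y ∷ δ) β) ∎
  where
  s = p <ᵇ y
  w = inits (α ++ [ y ]) y δ β

mutual
  cells-insert : ∀ {M} α γ p β → Below M α → Below M γ → Below M β →
    cells (α ++ M ∷ γ) p β ≡ kill (decreasing α) (cells (α ++ γ) p β)
  cells-insert {M} α γ p β α<M γ<M β<M = begin
    cell (active (α ++ M ∷ γ) β) (asc p β) (after (α ++ M ∷ γ) β)
      ≡⟨ cong₂ (λ a → cell a (asc p β)) (active-insertˡ α γ β α<M γ<M β<M) (after-insert α γ β α<M γ<M β<M) ⟩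
    cell (active (α ++ γ) β ∧ decreasing α ∧ decreasing β) (asc p β) (kill (decreasing α) (after (α ++ γ) β))
      ≡⟨ cong (λ d → cell (active (α ++ γ) β ∧ decreasing α ∧ d) (asc p β) (kill (decreasing α) (after (α ++ γ) β)))
           (sym (noAsc-after (α ++ γ) β)) ⟩
    cell (active (α ++ γ) β ∧ decreasing α ∧ noAsc (after (α ++ γ) β)) (asc p β) (kill (decreasing α) (after (α ++ γ) β))
      ≡⟨ sym (kill-cell (decreasing α) (active (α ++ γ) β) (asc p β) _) ⟩
    kill (decreasing α) (cells (α ++ γ) p β) ∎

  after-insert : ∀ {M} α γ β → Below M α → Below M γ → Below M β →
    after (α ++ M ∷ γ) β ≡ kill (decreasing α) (after (α ++ γ) β)
  after-insert α γ []      α<M γ<M β<M = refl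
  after-insert {M} α γ (y ∷ β) α<M γ<M (y<M ∷ β<M) = begin
    cells ((α ++ M ∷ γ) ++ [ y ]) y β                  ≡⟨ cong (λ α′ → cells α′ y β) (++-assoc α (M ∷ γ) [ y ]) ⟩
    cells (α ++ M ∷ (γ ++ [ y ])) y β                  ≡⟨ cells-insert α (γ ++ [ y ]) y β α<M (All.++⁺ γ<M (y<M ∷ [])) β<M ⟩
    kill (decreasing α) (cells (α ++ γ ++ [ y ]) y β)  ≡⟨ cong (λ α′ → kill (decreasing α) (cells α′ y β)) (sym (++-assoc α γ [ y ])) ⟩
    kill (decreasing α) (cells ((α ++ γ) ++ [ y ]) y β) ∎

asc-max : ∀ {M} β → Below M β → asc M β ≡ false
asc-max []      _         = refl
asc-max (y ∷ β) (y<M ∷ _) = <ᵇ-false (ℕ.<⇒≤ y<M)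

cells-max : ∀ {M} α β → Below M α → Below M β → active α β ≡ true →
  cells (α ++ [ M ]) M β ≡ kill (decreasing α) (• ∷ after α β)
cells-max {M} α β α<M β<M act = begin
  cells (α ++ [ M ]) M β
    ≡⟨ cells-insert α [] M β α<M [] β<M ⟩
  kill (decreasing α) (cells (α ++ []) M β)
    ≡⟨ cong (λ α′ → kill (decreasing α) (cells α′ M β)) (++-identityʳ α) ⟩
  kill (decreasing α) (cell (active α β) (asc M β) (after α β))
    ≡⟨ cong₂ (λ a s → kill (decreasing α) (cell a s (after α β))) act (asc-max β β<M) ⟩
  kill (decreasing α) (• ∷ after α β) ∎

lastOr-below : ∀ {M} p δ → Below M (p ∷ δ) → lastOr p δ < M
lastOr-below p []      (p<M ∷ _)   = p<M
lastOr-below p (y ∷ δ) (_ ∷ δ<M)   = lastOr-below y δ δ<M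

after-next : ∀ {M} x δ β → Below M (x ∷ δ) → Below M β → active (x ∷ δ) β ≡ true →
  after [] (x ∷ δ ++ M ∷ β) ≡ next (inits [ x ] x δ β) (after (x ∷ δ) β)
after-next {M} x δ β xδ<M@(x<M ∷ δ<M) β<M act = begin
  cells [ x ] x (δ ++ M ∷ β)
    ≡⟨ cells-++ [ x ] x δ (M ∷ β) ⟩
  inits [ x ] x δ (M ∷ β) ++ cell (active (x ∷ δ) (M ∷ β)) (lastOr x δ <ᵇ M) (cells (x ∷ δ ++ [ M ]) M β)
    ≡⟨ cong₂ (λ a s → inits [ x ] x δ (M ∷ β) ++ cell a s (cells (x ∷ δ ++ [ M ]) M β)) act′ (<ᵇ-true (lastOr-below x δ xδ<M)) ⟩
  inits [ x ] x δ (M ∷ β) ++ ▲ ∷ cells (x ∷ δ ++ [ M ]) M β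
    ≡⟨ cong₂ (λ u v → u ++ ▲ ∷ v) (inits-insert [ x ] x δ β (x<M ∷ []) δ<M β<M) (cells-max (x ∷ δ) β xδ<M β<M act) ⟩
  kill true (inits [ x ] x δ β) ++ ▲ ∷ kill (decreasing (x ∷ δ)) (• ∷ after (x ∷ δ) β)
    ≡⟨ cong (λ d → kill true (inits [ x ] x δ β) ++ ▲ ∷ kill d (• ∷ after (x ∷ δ) β)) (sym (noAsc-inits [ x ] x δ β)) ⟩
  next (inits [ x ] x δ β) (after (x ∷ δ) β) ∎
  where
  act′ : active (x ∷ δ) (M ∷ β) ≡ true
  act′ = trans (active-insertʳ (x ∷ δ) [] β xδ<M [] β<M) (trans (∧-identityʳ _) act)

-- Counting the avoiding extensions of a permutation

insertions : ℕ → List ℕ → List ℕ → List (List ℕ)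
insertions M α []      = [ α ++ [ M ] ]
insertions M α (y ∷ β) = (α ++ M ∷ y ∷ β) ∷ insertions M (α ++ [ y ]) β

extend : ℕ → ℕ → List ℕ → List (List ℕ)
extend zero    M σ = [ σ ]
extend (suc k) M σ = concatMap (extend k (suc M)) (insertions M [] σ)

numAvoiding : List (List ℕ) → ℤ
numAvoiding σs = + length (filter (λ σ → T? (avoids σ)) σs)

numAvoiding-++ : ∀ σs τs → numAvoiding (σs ++ τs) ≡ numAvoiding σs + numAvoiding τs
numAvoiding-++ σs τs = begin
  + length (filter P? (σs ++ τs))                        ≡⟨ cong (λ xs → + length xs) (filter-++ P? σs τs) ⟩
  + length (filter P? σs ++ filter P? τs)                ≡⟨ cong +_ (length-++ (filter P? σs)) ⟩
  + (length (filter P? σs) ℕ.+ length (filter P? τs))    ≡⟨ pos-+ (length (filter P? σs)) _ ⟩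
  numAvoiding σs + numAvoiding τs                        ∎
  where P? = λ σ → T? (avoids σ)

below-insert : ∀ {M} α {β} → Below M α → Below M β → Below (suc M) (α ++ M ∷ β)
below-insert α α<M β<M = All.++⁺ (All.map ℕ.m<n⇒m<1+n α<M) (ℕ.≤-refl ∷ All.map ℕ.m<n⇒m<1+n β<M)

mutual
  -- Occurrences persist under insertion. This justifies that `sumActive` passes over inactive
  -- sites: an insertion there has no avoiding continuation.
  extend-none : ∀ k {M} σ → Below M σ → avoids σ ≡ false → numAvoiding (extend k M σ) ≡ + 0
  extend-none zero    σ σ<M bad rewrite bad = refl
  extend-none (suc k) σ σ<M bad = insertions-none k [] σ [] σ<M bad

  insertions-none : ∀ k {M} α β → Below M α → Below M β → avoids (α ++ β) ≡ false →
    numAvoiding (concatMap (extend k (suc M)) (insertions M α β)) ≡ + 0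
  insertions-none k {M} α [] α<M β<M bad = begin
    numAvoiding (extend k (suc M) (α ++ [ M ]) ++ []) ≡⟨ cong numAvoiding (++-identityʳ (extend k (suc M) (α ++ [ M ]))) ⟩
    numAvoiding (extend k (suc M) (α ++ [ M ]))       ≡⟨ extend-none k _ (below-insert α α<M []) (trans (avoids-insert α [] α<M []) (cong (_∧ active α []) bad)) ⟩
    + 0                                               ∎
  insertions-none k {M} α (y ∷ β) α<M yβ<M@(y<M ∷ β<M) bad = begin
    numAvoiding (extend k (suc M) (α ++ M ∷ y ∷ β) ++ _)
      ≡⟨ numAvoiding-++ (extend k (suc M) (α ++ M ∷ y ∷ β)) _ ⟩
    numAvoiding (extend k (suc M) (α ++ M ∷ y ∷ β)) + numAvoiding (concatMap (extend k (suc M)) (insertions M (α ++ [ y ]) β))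
      ≡⟨ cong₂ _+_
          (extend-none k _ (below-insert α α<M yβ<M) (trans (avoids-insert α (y ∷ β) α<M yβ<M) (cong (_∧ active α (y ∷ β)) bad)))
          (insertions-none k (α ++ [ y ]) β (All.++⁺ α<M (y<M ∷ [])) β<M (trans (cong avoids (snoc-++ α y β)) bad)) ⟩
    + 0 ∎

sumActive-cell : ∀ (f : List Cell → List Cell → ℤ) a s w →
  sumActive f (cell a s w) ≡ (if a then f [] w else + 0) + sumActive (λ u v → f (cell a s u) v) w
sumActive-cell f false false w = sym (+-identityˡ _)
sumActive-cell f false true  w = refl
sumActive-cell f true  s     w = refl

if-congᵗ : ∀ {A : Set} b {x y z : A} → (b ≡ true → x ≡ y) → (if b then x else z) ≡ (if b then y else z)
if-congᵗ true  eq = eq refl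
if-congᵗ false eq = refl

if-intro : ∀ {A : Set} b {x y z : A} → (b ≡ true → x ≡ y) → (b ≡ false → x ≡ z) → x ≡ (if b then y else z)
if-intro true  then₁ else₁ = then₁ refl
if-intro false then₁ else₁ = else₁ refl

mutual
  -- The empty permutation is a case of its own, because `cells` needs an entry to the left of its
  -- first site; otherwise x, the first entry, provides one.
  numAvoiding-extend : ∀ k {M} σ → Below M σ → avoids σ ≡ true →
    numAvoiding (extend k M σ) ≡ weight k (active [] σ) (after [] σ)
  numAvoiding-extend zero    σ       σ<M good rewrite good = refl
  numAvoiding-extend (suc k) {M} [] σ<M good = begin
    numAvoiding (extend k (suc M) [ M ] ++ [])  ≡⟨ cong numAvoiding (++-identityʳ (extend k (suc M) [ M ])) ⟩
    numAvoiding (extend k (suc M) [ M ])        ≡⟨ insertion-weight k [] [] [] [] refl ⟩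
    weight k (active [] [ M ]) (after [] [ M ]) ≡⟨ cong₂ (weight k) (active-insertʳ {M} [] [] [] [] [] []) (cells-max {M} [] [] [] [] refl) ⟩
    weight k true (kill true (• ∷ []))          ≡⟨ sym (+-identityʳ _) ⟩
    weight k true (kill true (• ∷ [])) + + 0    ∎
  numAvoiding-extend (suc k) {M} (x ∷ β) xβ<M@(x<M ∷ β<M) good = begin
    numAvoiding (extend k (suc M) (M ∷ x ∷ β) ++ concatMap (extend k (suc M)) (insertions M [ x ] β))
      ≡⟨ numAvoiding-++ (extend k (suc M) (M ∷ x ∷ β)) _ ⟩
    numAvoiding (extend k (suc M) (M ∷ x ∷ β)) + numAvoiding (concatMap (extend k (suc M)) (insertions M [ x ] β))
      ≡⟨ cong₂ _+_ (trans (insertion-weight k [] (x ∷ β) [] xβ<M good) front)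
          (insertions-weight k x [] β (x<M ∷ []) β<M good) ⟩
    weight (suc k) (active [] (x ∷ β)) (after [] (x ∷ β)) ∎
    where
    front : (if active [] (x ∷ β) then weight k (active [] (M ∷ x ∷ β)) (after [] (M ∷ x ∷ β)) else + 0)
      ≡ (if active [] (x ∷ β) then weight k true (kill true (• ∷ after [] (x ∷ β))) else + 0)
    front = if-congᵗ (active [] (x ∷ β)) (λ act → cong₂ (weight k)
      (trans (active-insertʳ [] [] (x ∷ β) [] [] xβ<M) (trans (∧-identityʳ _) act))
      (cells-max [] (x ∷ β) [] xβ<M act))

  insertion-weight : ∀ k {M} α β → Below M α → Below M β → avoids (α ++ β) ≡ true →
    numAvoiding (extend k (suc M) (α ++ M ∷ β)) ≡
    (if active α β then weight k (active [] (α ++ M ∷ β)) (after [] (α ++ M ∷ β)) else + 0)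
  insertion-weight k α β α<M β<M good = if-intro (active α β)
    (λ act → numAvoiding-extend k _ (below-insert α α<M β<M) (trans (avoids-insert α β α<M β<M) (cong₂ _∧_ good act)))
    (λ act → extend-none k _ (below-insert α α<M β<M) (trans (avoids-insert α β α<M β<M) (cong₂ _∧_ good act)))

  -- The induction moves the entries of β one by one to the end of δ. The cells already passed,
  -- `inits [ x ] x δ β`, are what `sumActive` has accumulated up to this site.
  insertions-weight : ∀ k {M} x δ β → Below M (x ∷ δ) → Below M β → avoids (x ∷ δ ++ β) ≡ true →
    numAvoiding (concatMap (extend k (suc M)) (insertions M (x ∷ δ) β)) ≡
    sumActive (λ u v → weight k (active [] (x ∷ δ ++ β) ∧ noAsc (inits [ x ] x δ β ++ u)) (next (inits [ x ] x δ β ++ u) v))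
      (cells (x ∷ δ) (lastOr x δ) β)
  insertions-weight k {M} x δ [] xδ<M β<M good = begin
    numAvoiding (extend k (suc M) (x ∷ δ ++ [ M ]) ++ [])
      ≡⟨ cong numAvoiding (++-identityʳ (extend k (suc M) (x ∷ δ ++ [ M ]))) ⟩
    numAvoiding (extend k (suc M) (x ∷ δ ++ [ M ]))
      ≡⟨ trans (insertion-weight k (x ∷ δ) [] xδ<M [] good) (site-weight k x δ [] xδ<M []) ⟩
    (if active (x ∷ δ) [] then f [] [] else + 0)
      ≡⟨ sym (+-identityʳ _) ⟩
    (if active (x ∷ δ) [] then f [] [] else + 0) + + 0
      ≡⟨ sym (sumActive-cell f (active (x ∷ δ) []) false []) ⟩
    sumActive f (cells (x ∷ δ) (lastOr x δ) []) ∎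
    where
    f : List Cell → List Cell → ℤ
    f u v = weight k (active [] (x ∷ δ ++ []) ∧ noAsc (inits [ x ] x δ [] ++ u)) (next (inits [ x ] x δ [] ++ u) v)
  insertions-weight k {M} x δ (y ∷ β) xδ<M yβ<M@(y<M ∷ β<M) good = begin
    numAvoiding (extend k (suc M) (x ∷ δ ++ M ∷ y ∷ β) ++ _)
      ≡⟨ numAvoiding-++ (extend k (suc M) (x ∷ δ ++ M ∷ y ∷ β)) _ ⟩
    numAvoiding (extend k (suc M) (x ∷ δ ++ M ∷ y ∷ β)) + numAvoiding (concatMap (extend k (suc M)) (insertions M (x ∷ δ ++ [ y ]) β))
      ≡⟨ cong₂ _+_ (trans (insertion-weight k (x ∷ δ) (y ∷ β) xδ<M yβ<M good) (site-weight k x δ (y ∷ β) xδ<M yβ<M))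
           (insertions-weight k x (δ ++ [ y ]) β (All.++⁺ xδ<M (y<M ∷ [])) β<M (trans (cong avoids (snoc-++ (x ∷ δ) y β)) good)) ⟩
    (if a then f [] w else + 0) + sumActive (λ u v → f′ (inits [ x ] x (δ ++ [ y ]) β) (x ∷ (δ ++ [ y ]) ++ β) u v) (cells (x ∷ δ ++ [ y ]) (lastOr x (δ ++ [ y ])) β)
      -- Passing y extends the accumulated cells by the cell of the site before y, which is moved
      -- from the prefix into the argument of f.
      ≡⟨ cong (λ t → (if a then f [] w else + 0) + t) (trans
           (cong (λ p → sumActive (λ u v → f′ (inits [ x ] x (δ ++ [ y ]) β) (x ∷ (δ ++ [ y ]) ++ β) u v) (cells (x ∷ δ ++ [ y ]) p β)) (lastOr-snoc x δ y))
           (sumActive-cong (λ u v → trans (cong₂ (λ U τ → f′ U τ u v) (inits-snoc [ x ] x δ y β) (cong (x ∷_) (snoc-++ δ y β)))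
              (cong (λ U → weight k (active [] (x ∷ δ ++ y ∷ β) ∧ noAsc U) (next U v)) (regroup u))) w)) ⟩
    (if a then f [] w else + 0) + sumActive (λ u v → f (cell a s u) v) w
      ≡⟨ sym (sumActive-cell f a s w) ⟩
    sumActive f (cells (x ∷ δ) (lastOr x δ) (y ∷ β)) ∎
    where
    a = active (x ∷ δ) (y ∷ β)
    s = lastOr x δ <ᵇ y
    w = cells (x ∷ δ ++ [ y ]) y β
    U₀ = inits [ x ] x δ (y ∷ β)
    f′ : List Cell → List ℕ → List Cell → List Cell → ℤ
    f′ U τ u v = weight k (active [] τ ∧ noAsc (U ++ u)) (next (U ++ u) v)
    f : List Cell → List Cell → ℤ
    f = f′ U₀ (x ∷ δ ++ y ∷ β)
    regroup : ∀ u → (U₀ ++ cell a s []) ++ u ≡ U₀ ++ cell a s u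
    regroup u = trans (++-assoc U₀ _ u) (cong (U₀ ++_) (sym (cell-++ a s [] u)))

  site-weight : ∀ k {M} x δ β → Below M (x ∷ δ) → Below M β →
    (if active (x ∷ δ) β then weight k (active [] (x ∷ δ ++ M ∷ β)) (after [] (x ∷ δ ++ M ∷ β)) else + 0) ≡
    (if active (x ∷ δ) β then weight k (active [] (x ∷ δ ++ β) ∧ noAsc (inits [ x ] x δ β ++ [])) (next (inits [ x ] x δ β ++ []) (after (x ∷ δ) β)) else + 0)
  site-weight k x δ β xδ<M β<M = if-congᵗ (active (x ∷ δ) β) (λ act → cong₂ (weight k)
    (trans (active-insertʳ [] (x ∷ δ) β [] xδ<M β<M)
      (cong (active [] (x ∷ δ ++ β) ∧_) (trans (sym (noAsc-inits [ x ] x δ β)) (cong noAsc (sym (++-identityʳ (inits [ x ] x δ β)))))))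
    (trans (after-next x δ β xδ<M β<M act)
      (cong (λ U → next U (after (x ∷ δ) β)) (sym (++-identityʳ (inits [ x ] x δ β))))))

-- Permutations as iterated insertions

concatMap-unique : ∀ {A B : Set} (f : A → List B) xs → (∀ {x} → x ∈ xs → Unique (f x))
  → (∀ {x y w} → x ∈ xs → y ∈ xs → w ∈ f x → w ∈ f y → x ≡ y) → Unique xs → Unique (concatMap f xs)
concatMap-unique f []       fun inj _          = []
concatMap-unique f (x ∷ xs) fun inj (x∉ ∷ uxs) = Unique.++⁺ (fun (here refl))
  (concatMap-unique f xs (fun ∘ there) (λ y∈ z∈ → inj (there y∈) (there z∈)) uxs)
  (λ (w∈x , w∈xs) → let y , y∈ , w∈y = find (∈-concatMap⁻ f w∈xs) in
    All.lookup x∉ y∈ (inj (here refl) (there y∈) w∈x w∈y))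

occ-≡ : ∀ x w → occ x (x ∷ w) ≡ suc (occ x w)
occ-≡ x w rewrite to T-≡ (ℕ.≡⇒≡ᵇ x x refl) = refl

occ-≢ : ∀ {i x} w → i ≢ x → occ i (x ∷ w) ≡ occ i w
occ-≢ {i} {x} w i≢x rewrite ¬-not (λ eq → i≢x (ℕ.≡ᵇ⇒≡ i x (from T-≡ eq))) = refl

occ-below : ∀ {M} w → Below M w → occ M w ≡ 0
occ-below []      _           = refl
occ-below (x ∷ w) (x<M ∷ w<M) = trans (occ-≢ w (λ eq → ℕ.<⇒≢ x<M (sym eq))) (occ-below w w<M)

occ-insert : ∀ {M} α β → Below M α → Below M β → occ M (α ++ M ∷ β) ≡ 1
occ-insert {M} []      β _           β<M = trans (occ-≡ M β) (cong suc (occ-below β β<M))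
occ-insert     (x ∷ α) β (x<M ∷ α<M) β<M = trans (occ-≢ (α ++ _ ∷ β) (λ eq → ℕ.<⇒≢ x<M (sym eq))) (occ-insert α β α<M β<M)

below : ℕ → List ℕ → List ℕ
below M = filter (ℕ._<? M)

occ-below-filter : ∀ {i M} w → i < M → occ i (below M w) ≡ occ i w
occ-below-filter     []      i<M = refl
occ-below-filter {i} {M} (x ∷ w) i<M with x ℕ.<? M | i ℕ.≟ x
... | yes x<M | yes refl rewrite filter-accept (ℕ._<? M) {xs = w} x<M | occ-≡ i (below M w) | occ-≡ i w = cong suc (occ-below-filter w i<M)
... | yes x<M | no  i≢x  rewrite filter-accept (ℕ._<? M) {xs = w} x<M | occ-≢ (below M w) i≢x | occ-≢ w i≢x = occ-below-filter w i<M
... | no  x≮M | yes refl = contradiction i<M x≮M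
... | no  x≮M | no  i≢x  rewrite filter-reject (ℕ._<? M) {xs = w} x≮M | occ-≢ w i≢x = occ-below-filter w i<M

below-below : ∀ M w → below M (below (suc M) w) ≡ below M w
below-below M [] = refl
below-below M (x ∷ w) with x ℕ.<? suc M | x ℕ.<? M
... | yes x<1+M | yes x<M rewrite filter-accept (ℕ._<? suc M) {xs = w} x<1+M | filter-accept (ℕ._<? M) {xs = w} x<M | filter-accept (ℕ._<? M) {xs = below (suc M) w} x<M = cong (x ∷_) (below-below M w)
... | yes x<1+M | no  x≮M rewrite filter-accept (ℕ._<? suc M) {xs = w} x<1+M | filter-reject (ℕ._<? M) {xs = w} x≮M | filter-reject (ℕ._<? M) {xs = below (suc M) w} x≮M = below-below M w
... | no  x≮1+M | yes x<M = contradiction (ℕ.m<n⇒m<1+n x<M) x≮1+M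
... | no  x≮1+M | no  x≮M rewrite filter-reject (ℕ._<? suc M) {xs = w} x≮1+M | filter-reject (ℕ._<? M) {xs = w} x≮M = below-below M w

below-insert-cancel : ∀ {M} α β → Below M α → Below M β → below M (α ++ M ∷ β) ≡ α ++ β
below-insert-cancel {M} α β α<M β<M = begin
  below M (α ++ M ∷ β)        ≡⟨ filter-++ (ℕ._<? M) α (M ∷ β) ⟩
  below M α ++ below M (M ∷ β) ≡⟨ cong₂ _++_ (filter-all (ℕ._<? M) α<M) (filter-reject (ℕ._<? M) (ℕ.<-irrefl refl)) ⟩
  α ++ below M β              ≡⟨ cong (α ++_) (filter-all (ℕ._<? M) β<M) ⟩
  α ++ β                      ∎

∈-insertions⁻ : ∀ {M τ} α β → τ ∈ insertions M α β →
  ∃ λ β₁ → ∃ λ β₂ → β ≡ β₁ ++ β₂ × τ ≡ α ++ β₁ ++ M ∷ β₂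
∈-insertions⁻ α []      (here refl) = [] , [] , refl , refl
∈-insertions⁻ α (y ∷ β) (here refl) = [] , y ∷ β , refl , refl
∈-insertions⁻ α (y ∷ β) (there τ∈) with ∈-insertions⁻ (α ++ [ y ]) β τ∈
... | β₁ , β₂ , refl , refl = y ∷ β₁ , β₂ , refl , ++-assoc α [ y ] _

∈-insertions⁺ : ∀ M α β₁ β₂ → α ++ β₁ ++ M ∷ β₂ ∈ insertions M α (β₁ ++ β₂)
∈-insertions⁺ M α []       []       = here refl
∈-insertions⁺ M α []       (y ∷ β₂) = here refl
∈-insertions⁺ M α (y ∷ β₁) β₂       =
  there (subst (_∈ insertions M (α ++ [ y ]) (β₁ ++ β₂)) (++-assoc α [ y ] _) (∈-insertions⁺ M (α ++ [ y ]) β₁ β₂))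

insertions-unique : ∀ {M} α β → Below M β → Unique (insertions M α β)
insertions-unique α []      _ = [] ∷ []
insertions-unique {M} α (y ∷ β) (y<M ∷ β<M) = All.tabulate distinct ∷ insertions-unique (α ++ [ y ]) β β<M
  where
  distinct : ∀ {τ} → τ ∈ insertions M (α ++ [ y ]) β → α ++ M ∷ y ∷ β ≢ τ
  distinct τ∈ eq with ∈-insertions⁻ (α ++ [ y ]) β τ∈
  ... | β₁ , β₂ , _ , refl = ℕ.<⇒≢ y<M (sym (∷-injectiveˡ (++-cancelˡ α _ _ (trans eq (++-assoc α [ y ] _)))))

removeMax : ∀ {M} τ → Below (suc M) τ → occ M τ ≡ 1 → ∃ λ α → ∃ λ β → τ ≡ α ++ M ∷ β × Below M α × Below M β
removeMax {M} (x ∷ τ) (x<1+M ∷ τ<1+M) once with M ℕ.≟ x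
... | yes refl = [] , τ , refl , [] , belowMax τ τ<1+M (ℕ.suc-injective (trans (sym (occ-≡ x τ)) once))
  where
  belowMax : ∀ τ → Below (suc M) τ → occ M τ ≡ 0 → Below M τ
  belowMax []      _                _    = []
  belowMax (y ∷ τ) (y<1+M ∷ τ<1+M) none with M ℕ.≟ y
  ... | yes refl = contradiction (trans (sym (occ-≡ y τ)) none) λ ()
  ... | no  M≢y  = ℕ.≤∧≢⇒< (ℕ.s≤s⁻¹ y<1+M) (M≢y ∘ sym) ∷ belowMax τ τ<1+M (trans (sym (occ-≢ τ M≢y)) none)
... | no M≢x with removeMax τ τ<1+M (trans (sym (occ-≢ τ M≢x)) once)
...   | α , β , refl , α<M , β<M = x ∷ α , β , refl , ℕ.≤∧≢⇒< (ℕ.s≤s⁻¹ x<1+M) (M≢x ∘ sym) ∷ α<M , β<M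

-- w arises from σ by inserting M, M + 1, …, M + k − 1.
record Extension (k M : ℕ) (σ w : List ℕ) : Set where
  field
    restricts : below M w ≡ σ
    bounded   : Below (k ℕ.+ M) w
    once      : ∀ i → M ≤ i → i < k ℕ.+ M → occ i w ≡ 1

open Extension

-- The length is carried along because `isPermOf` tests it.
∈-extend⁻ : ∀ k {M w} σ → Below M σ → w ∈ extend k M σ → Extension k M σ w × length w ≡ k ℕ.+ length σ
∈-extend⁻ zero {M} σ σ<M (here refl) = record
  { restricts = filter-all (ℕ._<? M) σ<M
  ; bounded   = σ<M
  ; once      = λ i M≤i i<M → contradiction i<M (ℕ.≤⇒≯ M≤i)
  } , refl
∈-extend⁻ (suc k) {M} {w} σ σ<M w∈ with find (∈-concatMap⁻ (extend k (suc M)) w∈)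
... | τ , τ∈ , w∈τ with ∈-insertions⁻ [] σ τ∈
...   | α , β , refl , refl with ∈-extend⁻ k (α ++ M ∷ β) (below-insert α (All.++⁻ˡ α σ<M) (All.++⁻ʳ α σ<M)) w∈τ
...     | ext , len = record
  { restricts = trans (sym (below-below M w)) (trans (cong (below M) (restricts ext)) (below-insert-cancel α β α<M β<M))
  ; bounded   = subst (λ N → Below N w) (ℕ.+-suc k M) (bounded ext)
  ; once      = λ i M≤i i<N → onceFrom i (ℕ.m≤n⇒m<n∨m≡n M≤i) (subst (i <_) (sym (ℕ.+-suc k M)) i<N)
  } , trans len (trans (cong (k ℕ.+_) (trans (length-++ α) (trans (ℕ.+-suc (length α) (length β)) (cong suc (sym (length-++ α)))))) (ℕ.+-suc k _))
  where
  α<M = All.++⁻ˡ α σ<M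
  β<M = All.++⁻ʳ α σ<M
  onceFrom : ∀ i → M < i ⊎ M ≡ i → i < k ℕ.+ suc M → occ i w ≡ 1
  onceFrom i (inj₁ M<i)  i<N = once ext i M<i i<N
  onceFrom i (inj₂ refl) i<N =
    trans (sym (occ-below-filter w (ℕ.n<1+n M))) (trans (cong (occ M) (restricts ext)) (occ-insert α β α<M β<M))

-- The first insertion can be read off w: its entries up to M contain M once, and deleting M from
-- them leaves σ.
∈-extend⁺ : ∀ k {M w} σ → Extension k M σ w → w ∈ extend k M σ
∈-extend⁺ zero {M} {w} σ ext = here (trans (sym (filter-all (ℕ._<? M) (bounded ext))) (restricts ext))
∈-extend⁺ (suc k) {M} {w} σ ext with removeMax (below (suc M) w) (All.all-filter (ℕ._<? suc M) w)
  (trans (occ-below-filter w (ℕ.n<1+n M)) (once ext M ℕ.≤-refl (ℕ.s≤s (ℕ.m≤n+m M k))))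
... | α , β , eq , α<M , β<M = ∈-concatMap⁺ (extend k (suc M))
  (lose τ∈ (∈-extend⁺ k (α ++ M ∷ β) record
    { restricts = eq
    ; bounded   = subst (λ N → Below N w) (sym (ℕ.+-suc k M)) (bounded ext)
    ; once      = λ i M<i i<N → once ext i (ℕ.<⇒≤ M<i) (subst (i <_) (ℕ.+-suc k M) i<N)
    }))
  where
  σ≡ : σ ≡ α ++ β
  σ≡ = trans (sym (restricts ext)) (trans (sym (below-below M w)) (trans (cong (below M) eq) (below-insert-cancel α β α<M β<M)))
  τ∈ : α ++ M ∷ β ∈ insertions M [] σ
  τ∈ = subst (λ ρ → α ++ M ∷ β ∈ insertions M [] ρ) (sym σ≡) (∈-insertions⁺ M [] α β)

insertion-below : ∀ {M τ} σ → Below M σ → τ ∈ insertions M [] σ → Below (suc M) τ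
insertion-below σ σ<M τ∈ with ∈-insertions⁻ [] σ τ∈
... | α , β , refl , refl = below-insert α (All.++⁻ˡ α σ<M) (All.++⁻ʳ α σ<M)

-- Different first insertions have no common extension, since the first insertion is recovered from
-- w as `below (suc M) w`.
extend-unique : ∀ k {M} σ → Below M σ → Unique (extend k M σ)
extend-unique zero        σ σ<M = [] ∷ []
extend-unique (suc k) {M} σ σ<M = concatMap-unique (extend k (suc M)) (insertions M [] σ)
  (λ τ∈ → extend-unique k _ (insertion-below σ σ<M τ∈))
  (λ τ∈ τ′∈ w∈ w∈′ → trans (sym (restricts (proj₁ (∈-extend⁻ k _ (insertion-below σ σ<M τ∈) w∈))))
                            (restricts (proj₁ (∈-extend⁻ k _ (insertion-below σ σ<M τ′∈) w∈′))))
  (insertions-unique [] σ σ<M)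

allWords-unique : ∀ n k → Unique (allWords n k)
allWords-unique n zero    = [] ∷ []
allWords-unique n (suc k) = concatMap-unique _ (allWords n k)
  (λ _ → Unique.map⁺ (ℕ.suc-injective ∘ ∷-injectiveˡ) (Unique.upTo⁺ n))
  (λ {x} {y} _ _ w∈ w∈′ → let _ , _ , eq = ∈-map⁻ (λ i → suc i ∷ x) w∈ ; _ , _ , eq′ = ∈-map⁻ (λ i → suc i ∷ y) w∈′ in
    ∷-injectiveʳ (trans (sym eq) eq′))
  (allWords-unique n k)

InRange : ℕ → ℕ → Set
InRange n x = 1 ≤ x × x ≤ n

∈-allWords⁻ : ∀ n k {w} → w ∈ allWords n k → All (InRange n) w
∈-allWords⁻ n zero    (here refl) = []
∈-allWords⁻ n (suc k) w∈ with find (∈-concatMap⁻ (λ w → map (λ i → suc i ∷ w) (upTo n)) {xs = allWords n k} w∈)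
... | w′ , w′∈ , w∈′ with ∈-map⁻ (λ i → suc i ∷ w′) w∈′
...   | i , i∈ , refl = (ℕ.s≤s ℕ.z≤n , ∈-upTo⁻ i∈) ∷ ∈-allWords⁻ n k w′∈

∈-allWords⁺ : ∀ n w → All (InRange n) w → w ∈ allWords n (length w)
∈-allWords⁺ n []          _                   = here refl
∈-allWords⁺ n (suc x ∷ w) ((_ , x<n) ∷ range) =
  ∈-concatMap⁺ _ (lose (∈-allWords⁺ n w range) (∈-map⁺ (λ i → suc i ∷ w) (∈-upTo⁺ x<n)))

∈-Sn⇔∈-extend : ∀ n {w} → w ∈ Sn n ⇔ w ∈ extend n 1 []
∈-Sn⇔∈-extend n {w} = mk⇔ to′ from′
  where
  to′ : w ∈ Sn n → w ∈ extend n 1 []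
  to′ w∈ with ∈-filter⁻ (λ w → T? (isPermOf n w)) w∈
  ... | w∈all , perm = ∈-extend⁺ n [] record
    { restricts = filter-none (ℕ._<? 1) (All.map (λ (1≤x , _) → ℕ.≤⇒≯ 1≤x) range)
    ; bounded   = All.map (λ {x} (_ , x≤n) → subst (x <_) (sym (ℕ.+-comm n 1)) (ℕ.s≤s x≤n)) range
    ; once      = λ { (suc i) _ i<n → ℕ.≡ᵇ⇒≡ _ 1 (All.lookup (All.all⁺ _ (upTo n) (proj₂ (to T-∧ perm)))
                    (∈-upTo⁺ (ℕ.s≤s⁻¹ (subst (suc i <_) (ℕ.+-comm n 1) i<n)))) }
    }
    where range = ∈-allWords⁻ n n w∈all
  from′ : w ∈ extend n 1 [] → w ∈ Sn n
  from′ w∈ with ∈-extend⁻ n [] [] w∈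
  ... | ext , len = ∈-filter⁺ (λ w → T? (isPermOf n w))
    (subst (λ k → w ∈ allWords n k) len′ (∈-allWords⁺ n w (All.tabulate inRange)))
    (from T-∧ (ℕ.≡⇒≡ᵇ (length w) n len′ , All.all⁻ (λ i → occ (suc i) w ≡ᵇ 1) (All.tabulate λ {i} i∈ →
      ℕ.≡⇒≡ᵇ (occ (suc i) w) 1 (once ext (suc i) (ℕ.s≤s ℕ.z≤n) (subst (suc i <_) (ℕ.+-comm 1 n) (ℕ.s≤s (∈-upTo⁻ i∈)))))))
    where
    len′ : length w ≡ n
    len′ = trans len (ℕ.+-identityʳ n)
    inRange : ∀ {x} → x ∈ w → InRange n x
    -- An entry 0 would survive in `below 1 w`, which is empty.
    inRange {zero}  x∈ with () ← subst (0 ∈_) (restricts ext) (∈-filter⁺ (ℕ._<? 1) x∈ (ℕ.s≤s ℕ.z≤n))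
    inRange {suc x} x∈ = ℕ.s≤s ℕ.z≤n , ℕ.s≤s⁻¹ (subst (suc x <_) (ℕ.+-comm n 1) (All.lookup (bounded ext) x∈))

Sn-unique : ∀ n → Unique (Sn n)
Sn-unique n = Unique.filter⁺ (λ w → T? (isPermOf n w)) (allWords-unique n n)

-- Two duplicate-free lists with the same members are rearrangements of each other, so filtering
-- leaves equally many entries in both.
countAvoiders≡avoiders : ∀ n → + countAvoiders patternsT n ≡ avoiders n
countAvoiders≡avoiders n = begin
  numAvoiding (Sn n)          ≡⟨ cong +_ (↭-length (filter-↭ (λ σ → T? (avoids σ)) (∼bag⇒↭
                                   (unique∧set⇒bag (Sn-unique n) (extend-unique n [] []) (∈-Sn⇔∈-extend n))))) ⟩
  numAvoiding (extend n 1 []) ≡⟨ numAvoiding-extend n [] [] refl ⟩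
  weight n true []            ≡⟨ weight-root n ⟩
  avoiders n                  ∎

theorem3p22 : (n : ℕ) → convCoeff denominator (countAvoiders patternsT) n ≡ coeff numerator n
theorem3p22 n = begin
  convCoeff denominator (countAvoiders patternsT) n
    ≡⟨ convCoeff≡partialConv denominator (countAvoiders patternsT) n ⟩
  partialConv denominator (λ m → + countAvoiders patternsT m) n n
    ≡⟨ partialConv-cong denominator countAvoiders≡avoiders n n ⟩
  partialConv denominator avoiders n n
    ≡⟨ conv-avoiders n ⟩
  coeff numerator n ∎
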